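{- Let $d\geq 1$, $r\geq d+1$, $1\leq m\leq r$ and $m\leq k\leq \min\{m+d,r\}$ be integers. Let $P$ be a finite family of points in $\mathbb{R}^d$ colored with $r$ colors, with $|P|\geq \max\{m+d,r\}$. Assume that for every choice of $r-k+1$ color classes, the convex hull of their union contains the origin. Then there is some $\{u_1,\ldots,u_d,v_1,\ldots,v_m\}\subset P$ (of $d+m$ distinct members), colored with at least $k$ different colors, such that $0\in \operatorname{conv}(\{u_1,\ldots,u_d,v_i\})$ for all $i\in\{1,\ldots,m\}$.
   Context: A family colored with $r$ colors is partitioned into $r$ color classes. $\operatorname{conv}$ denotes the convex hull. -}

module Defs where

open import Data.Nat using (ℕ; zero; suc)
open import Data.Fin using (Fin; zero; suc)
open import Data.Fin.Subset using (Subset; _∈_)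
open import Data.Vec using (tabulate)
open import Data.Bool using (Bool)
open import Data.Product using (Σ; ∃; _×_; _,_)
open import Data.Sum using (_⊎_)
open import Relation.Nullary using (¬_; does)
open import Relation.Nullary.Decidable using (⌊_⌋)
open import Relation.Binary.PropositionalEquality using (_≡_)
open import Relation.Binary.Structures using (IsStrictTotalOrder)
open import Algebra.Structures using (IsCommutativeRing)
import Data.Fin as F
open import Data.Fin.Properties using (any?)

-- The real numbers, axiomatised (classically) as a complete ordered field.
-- Any model is isomorphic to ℝ, so quantifying over all models is the
-- same as speaking about ℝ.
record RealField : Set₁ where
  infixl 6 _+_
  infixl 7 _*_
  infix 4 _<_ _≤_
  field
    Carrier : Set
    _+_ _*_ : Carrier → Carrier → Carrier
    -_ : Carrier → Carrier
    0# 1# : Carrier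
    _<_ : Carrier → Carrier → Set
    isCommutativeRing : IsCommutativeRing _≡_ _+_ _*_ -_ 0# 1#
    isStrictTotalOrder : IsStrictTotalOrder _≡_ _<_
    0≢1 : ¬ (0# ≡ 1#)
    inverse : ∀ x → ¬ (x ≡ 0#) → ∃ λ y → x * y ≡ 1#
    +-mono-< : ∀ {x y} z → x < y → x + z < y + z
    *-pos : ∀ {x y} → 0# < x → 0# < y → 0# < x * y

  _≤_ : Carrier → Carrier → Set
  x ≤ y = x < y ⊎ x ≡ y

  field
    complete : (S : Carrier → Set) → (∃ λ x → S x) →
               (∃ λ b → ∀ x → S x → x ≤ b) →
               ∃ λ s → (∀ x → S x → x ≤ s) × (∀ b → (∀ x → S x → x ≤ b) → s ≤ b)

module _ (R : RealField) where
  open RealField R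

  Point : ℕ → Set
  Point d = Fin d → Carrier

  ∑ : ∀ {q} → (Fin q → Carrier) → Carrier
  ∑ {zero} f = 0#
  ∑ {suc q} f = f zero + ∑ (λ i → f (suc i))

  0∈conv : ∀ {d q} → (Fin q → Point d) → (Fin q → Set) → Set
  0∈conv {d} {q} pts S =
    Σ (Fin q → Carrier) λ c →
      (∀ i → 0# ≤ c i) × (∀ i → ¬ S i → c i ≡ 0#) × (∑ c ≡ 1#) ×
      (∀ (t : Fin d) → ∑ (λ i → c i * pts i t) ≡ 0#)

colorsUsed : ∀ {q r} → (Fin q → Fin r) → Subset r
colorsUsed {q} col = tabulate λ c → does (any? λ j → col j F.≟ c)

cons : ∀ {A : Set} {d} → A → (Fin d → A) → Fin (suc d) → A
cons v u zero = v
cons v u (suc j) = u j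

{-# OPTIONS --safe #-}

-- Bárány's minimisation argument. Among the d-tuples u with at least k − m colours choose one whose convex hull
-- is closest to the origin, and let p be the nearest point. Let v be a point with ⟨p, v⟩ ≤ 0, which, if u has
-- exactly k − m colours, does not have a colour of u. If 0 ∉ conv(u, v), then the point of conv(u, v) nearest to 0
-- is closer than p and, by Carathéodory's theorem in its supporting hyperplane, lies in the hull of d of the d + 1
-- points; this d-tuple is again admissible, which contradicts the choice of u. So all these v qualify. By
-- hypothesis the half-space ⟨p, ·⟩ ≤ 0 contains points of at least k colours, so v₁, …, vₘ can be chosen greedily.
-- If p = 0, every v qualifies.

module Submission where

open import Defs
open import Algebra.Bundles using (CommutativeRing; RawRing)
import Algebra.Properties.AbelianGroup
import Algebra.Properties.Ring
import Algebra.Properties.Semiring.Mult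
import Algebra.Solver.Ring
open import Algebra.Solver.Ring.AlmostCommutativeRing
  using (AlmostCommutativeRing; fromCommutativeRing; _-Raw-AlmostCommutative⟶_)
open import Data.Fin as Fin
  using (Fin; zero; suc; _↑ˡ_; _↑ʳ_; splitAt; punchIn; punchOut; finToFun; funToFin)
open import Data.Fin.Induction using (spo-wellFounded)
open import Data.Fin.Properties using
  (any?; punchIn-punchOut; punchIn-injective; splitAt⁻¹-↑ˡ; splitAt⁻¹-↑ʳ; finToFun-funToFin)
open import Data.Fin.Subset as Sub
  using (Subset; inside; outside; _∈_; _∉_; _⊆_; _∪_; ∁; ⁅_⁆; ∣_∣)
open import Data.Fin.Subset.Properties using
  ( _∈?_; ∉⊥; ∣⊥∣≡0; ∣⊤∣≡n; ∣⁅x⁆∣≡1; x∈⁅x⁆; x∈⁅y⁆⇒x≡y; s⊆s; p⊆p∪q; q⊆p∪q; x∈p∪q⁻; ∣p∣≤∣p∪q∣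
  ; p⊆q⇒∣p∣≤∣q∣; p⊂q⇒∣p∣<∣q∣; ∣∁p∣≡n∸∣p∣; x∈∁p⇒x∉p)
open import Data.Maybe using (Maybe; just; nothing)
open import Data.Nat as ℕ using (ℕ; zero; suc; z≤n; s≤s)
import Data.Nat.Properties as ℕₚ
open import Data.Product using (Σ; ∃; _×_; _,_; proj₁; proj₂)
open import Data.Sum using (_⊎_; inj₁; inj₂)
open import Data.Unit using (⊤; tt)
open import Data.Vec using ([]; _∷_)
open import Data.Vec.Functional using (insertAt; _++_)
open import Data.Vec.Functional.Properties using (insertAt-lookup; insertAt-punchIn; lookup-++ˡ; lookup-++ʳ)
open import Data.Vec.N-ary using (N-ary; Eq; Eqʰ; curryⁿ)
open import Data.Vec.Properties using (lookup⇒[]=; []=⇒lookup; lookup∘tabulate)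
open import Function using (_∘_; id; case_of_)
open import Function.Definitions using (Injective)
open import Induction.WellFounded using (WellFounded; Acc; acc)
import Relation.Binary.Construct.StrictToNonStrict as StrictToNonStrict
open import Relation.Binary.Definitions using (tri<; tri≈; tri>)
open import Relation.Binary.PropositionalEquality
  using (_≡_; _≢_; _≗_; refl; sym; trans; cong; cong₂; subst; subst₂; isEquivalence; module ≡-Reasoning)
import Relation.Binary.Reflection as Reflection
open import Relation.Binary.Structures using (IsStrictTotalOrder; IsDecTotalOrder)
open import Relation.Nullary using (¬_; Dec; yes; no; does; ¬?; contradiction)
open import Relation.Nullary.Decidable using (decidable-stable; dec-true; _×-dec_; _⊎-dec_)

-- Passing from u to d of the d + 1 points of (u, v) loses at most one of the colours of (u, v). So
-- u must have a colour to spare, or v must bring a new one; this is the origin of the condition on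
-- v. It leaves enough choices: if u has exactly k - m colours, at least m of the k colours in the
-- half-space are missing from u. The members of u satisfy ⟨p, u_j⟩ ≥ ‖p‖², so for p ≠ 0 they lie
-- outside the half-space and v is automatically distinct from them. For p = 0 this breaks down, and
-- distinctness comes from |P| ≥ m + d. All minima come from finite searches. A nearest point is a
-- convex combination p of the x_i with ⟨p, x_i⟩ ≥ ‖p‖² for all i; this implies minimality over the
-- hull, and such a p is built by induction on the number of points, using orthogonal projection
-- onto affine hulls.

-- Arithmetic in an ordered field, with a ring solver.

module OrderedField (R : RealField) where
  open RealField R public

  commutativeRing : CommutativeRing _ _
  commutativeRing = record { isCommutativeRing = isCommutativeRing }

  open CommutativeRing commutativeRing public using
    ( +-assoc; +-comm; +-identityˡ; +-identityʳ; -‿inverseʳ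
    ; *-assoc; *-comm; *-identityˡ; *-identityʳ; zeroˡ; zeroʳ; distribˡ; distribʳ)

  private
    module Ringₚ = Algebra.Properties.Ring (CommutativeRing.ring commutativeRing)
    module Groupₚ = Algebra.Properties.AbelianGroup (CommutativeRing.+-abelianGroup commutativeRing)
    open Algebra.Properties.Semiring.Mult (CommutativeRing.semiring commutativeRing)
      using (×-homo-+; ×1-homo-*) renaming (_×_ to _⋆_)

    interchange : ∀ a b c d → (a + b) + (c + d) ≡ (a + c) + (b + d)
    interchange a b c d = begin
      (a + b) + (c + d) ≡⟨ +-assoc a b (c + d) ⟩
      a + (b + (c + d)) ≡⟨ cong (a +_) (sym (+-assoc b c d)) ⟩
      a + ((b + c) + d) ≡⟨ cong (λ e → a + (e + d)) (+-comm b c) ⟩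
      a + ((c + b) + d) ≡⟨ cong (a +_) (+-assoc c b d) ⟩
      a + (c + (b + d)) ≡⟨ sym (+-assoc a c (b + d)) ⟩
      (a + c) + (b + d) ∎
      where open ≡-Reasoning

    -- The pair (a , b) stands for the integer a − b.
    -- Cancelling common successors makes equal integers syntactically equal in the solver's normal forms.
    cancel : ℕ × ℕ → ℕ × ℕ
    cancel (suc a , suc b) = cancel (a , b)
    cancel x = x

    add mul : ℕ × ℕ → ℕ × ℕ → ℕ × ℕ
    add (a , b) (c , d) = a ℕ.+ c , b ℕ.+ d
    mul (a , b) (c , d) = a ℕ.* c ℕ.+ b ℕ.* d , a ℕ.* d ℕ.+ b ℕ.* c

    coefficients : RawRing _ _
    coefficients = record
      { Carrier = ℕ × ℕ
      ; _≈_ = _≡_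
      ; _+_ = λ x y → cancel (add x y)
      ; _*_ = λ x y → cancel (mul x y)
      ; -_ = λ (a , b) → b , a
      ; 0# = 0 , 0
      ; 1# = 1 , 0
      }

    module C = RawRing coefficients

    value′ : ℕ × ℕ → Carrier
    value′ (a , b) = a ⋆ 1# + - (b ⋆ 1#)

    -- Agrees with value′; the first two clauses let the solver's constants unfold to 0# and 1#.
    value : ℕ × ℕ → Carrier
    value (0 , 0) = 0#
    value (1 , 0) = 1#
    value x = value′ x

    value≡value′ : ∀ x → value x ≡ value′ x
    value≡value′ (0 , 0) = sym (-‿inverseʳ 0#)
    value≡value′ (0 , suc _) = refl
    value≡value′ (1 , 0) = sym (trans (cong₂ _+_ (+-identityʳ 1#) Ringₚ.-0#≈0#) (+-identityʳ 1#))
    value≡value′ (1 , suc _) = refl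
    value≡value′ (suc (suc _) , _) = refl

    target : AlmostCommutativeRing _ _
    target = fromCommutativeRing commutativeRing

    value′-+ : ∀ x y → value′ (add x y) ≡ value′ x + value′ y
    value′-+ (a , b) (c , d) = begin
      (a ℕ.+ c) ⋆ 1# + - ((b ℕ.+ d) ⋆ 1#)
        ≡⟨ cong₂ (λ x y → x + - y) (×-homo-+ 1# a c) (×-homo-+ 1# b d) ⟩
      (A + C) + - (B + D)
        ≡⟨ cong ((A + C) +_) (sym (Groupₚ.⁻¹-∙-comm B D)) ⟩
      (A + C) + (- B + - D)
        ≡⟨ interchange A C (- B) (- D) ⟩
      (A + - B) + (C + - D) ∎
      where
      open ≡-Reasoning
      A = a ⋆ 1#
      B = b ⋆ 1#
      C = c ⋆ 1#
      D = d ⋆ 1#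

    value′-* : ∀ x y → value′ (mul x y) ≡ value′ x * value′ y
    value′-* (a , b) (c , d) = begin
      (a ℕ.* c ℕ.+ b ℕ.* d) ⋆ 1# + - ((a ℕ.* d ℕ.+ b ℕ.* c) ⋆ 1#)
        ≡⟨ cong₂ (λ x y → x + - y)
             (trans (×-homo-+ 1# (a ℕ.* c) (b ℕ.* d)) (cong₂ _+_ (×1-homo-* a c) (×1-homo-* b d)))
             (trans (×-homo-+ 1# (a ℕ.* d) (b ℕ.* c)) (cong₂ _+_ (×1-homo-* a d) (×1-homo-* b c))) ⟩
      (A * C + B * D) + - (A * D + B * C)
        ≡⟨ cong ((A * C + B * D) +_) (sym (Groupₚ.⁻¹-∙-comm (A * D) (B * C))) ⟩
      (A * C + B * D) + (- (A * D) + - (B * C))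
        ≡⟨ cong ((A * C + B * D) +_) (+-comm _ _) ⟩
      (A * C + B * D) + (- (B * C) + - (A * D))
        ≡⟨ interchange _ _ _ _ ⟩
      (A * C + - (B * C)) + (B * D + - (A * D))
        ≡⟨ cong₂ _+_ (sym (Ringₚ.[y-z]x≈yx-zx C A B))
             (trans (+-comm _ _) (trans (cong₂ _+_ (Ringₚ.-‿distribʳ-* A D) refl)
               (cong (A * - D +_) (trans (sym (Groupₚ.⁻¹-involutive _))
                 (trans (cong -_ (Ringₚ.-‿distribʳ-* B D)) (Ringₚ.-‿distribˡ-* B (- D))))))) ⟩
      (A + - B) * C + (A * - D + - B * - D)
        ≡⟨ cong ((A + - B) * C +_) (sym (distribʳ (- D) A (- B))) ⟩
      (A + - B) * C + (A + - B) * - D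
        ≡⟨ sym (distribˡ (A + - B) C (- D)) ⟩
      (A + - B) * (C + - D) ∎
      where
      open ≡-Reasoning
      A = a ⋆ 1#
      B = b ⋆ 1#
      C = c ⋆ 1#
      D = d ⋆ 1#

    value′-neg : ∀ x → value′ (C.-_ x) ≡ - value′ x
    value′-neg (a , b) = begin
      b ⋆ 1# + - (a ⋆ 1#)          ≡⟨ +-comm _ _ ⟩
      - (a ⋆ 1#) + b ⋆ 1#          ≡⟨ cong (- (a ⋆ 1#) +_) (sym (Groupₚ.⁻¹-involutive _)) ⟩
      - (a ⋆ 1#) + - - (b ⋆ 1#)    ≡⟨ Groupₚ.⁻¹-∙-comm _ _ ⟩
      - (a ⋆ 1# + - (b ⋆ 1#))      ∎
      where open ≡-Reasoning

    value′-cong : ∀ a b c d → a ℕ.+ d ≡ c ℕ.+ b → value′ (a , b) ≡ value′ (c , d)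
    value′-cong a b c d e = begin
      A + - B                    ≡⟨ sym (+-identityʳ _) ⟩
      (A + - B) + 0#             ≡⟨ cong ((A + - B) +_) (sym (-‿inverseʳ D)) ⟩
      (A + - B) + (D + - D)      ≡⟨ interchange A (- B) D (- D) ⟩
      (A + D) + (- B + - D)      ≡⟨ cong (_+ (- B + - D)) e′ ⟩
      (C + B) + (- B + - D)      ≡⟨ cong ((C + B) +_) (+-comm _ _) ⟩
      (C + B) + (- D + - B)      ≡⟨ interchange C B (- D) (- B) ⟩
      (C + - D) + (B + - B)      ≡⟨ cong ((C + - D) +_) (-‿inverseʳ B) ⟩
      (C + - D) + 0#             ≡⟨ +-identityʳ _ ⟩
      C + - D                    ∎
      where
      open ≡-Reasoning
      A = a ⋆ 1#
      B = b ⋆ 1#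
      C = c ⋆ 1#
      D = d ⋆ 1#
      e′ : A + D ≡ C + B
      e′ = trans (sym (×-homo-+ 1# a d)) (trans (cong (_⋆ 1#) e) (×-homo-+ 1# c b))

    value′-cancel : ∀ x → value′ (cancel x) ≡ value′ x
    value′-cancel (zero , _) = refl
    value′-cancel (suc _ , zero) = refl
    value′-cancel (suc a , suc b) = trans (value′-cancel (a , b)) (value′-cong a b (suc a) (suc b) (ℕₚ.+-suc a b))

    coefficient-morphism : coefficients -Raw-AlmostCommutative⟶ target
    coefficient-morphism = record
      { ⟦_⟧ = value
      ; +-homo = λ x y → trans (value≡value′ (x C.+ y)) (trans (trans (value′-cancel (add x y)) (value′-+ x y))
          (sym (cong₂ _+_ (value≡value′ x) (value≡value′ y))))
      ; *-homo = λ x y → trans (value≡value′ (x C.* y)) (trans (trans (value′-cancel (mul x y)) (value′-* x y))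
          (sym (cong₂ _*_ (value≡value′ x) (value≡value′ y))))
      ; -‿homo = λ x → trans (value≡value′ (C.-_ x)) (trans (value′-neg x) (sym (cong -_ (value≡value′ x))))
      ; 0-homo = refl
      ; 1-homo = refl
      }

    value-≟ : ∀ x y → Maybe (value x ≡ value y)
    value-≟ x@(a , b) y@(c , d) with a ℕ.+ d ℕ.≟ c ℕ.+ b
    ... | no _ = nothing
    ... | yes e = just (trans (value≡value′ x) (trans (value′-cong a b c d e) (sym (value≡value′ y))))

  private
    module Solver = Algebra.Solver.Ring coefficients target coefficient-morphism value-≟
    open Reflection (AlmostCommutativeRing.setoid target) Solver.var Solver.⟦_⟧ Solver.⟦_⟧↓ Solver.correct
      using (close)

  open Solver public using (con; _:+_; _:*_; :-_; _:=_; Polynomial)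

  -- Opaque, since with-abstraction would otherwise normalise the generated proofs.
  opaque
    solve : ∀ n (f : N-ary n (Polynomial n) (Polynomial n × Polynomial n)) →
            Eqʰ n _≡_ (curryⁿ Solver.⟦ proj₁ (close n f) ⟧↓) (curryⁿ Solver.⟦ proj₂ (close n f) ⟧↓) →
            Eq n _≡_ (curryⁿ Solver.⟦ proj₁ (close n f) ⟧) (curryⁿ Solver.⟦ proj₂ (close n f) ⟧)
    solve = Solver.solve

  private
    module O = IsStrictTotalOrder isStrictTotalOrder
    module ≤ = IsDecTotalOrder (StrictToNonStrict.isDecTotalOrder _≡_ _<_ isStrictTotalOrder)

  one : ∀ {n} → Polynomial n
  one = con (1 , 0)

  nil : ∀ {n} → Polynomial n
  nil = con (0 , 0)

  open O public using (compare) renaming (irrefl to <-irrefl; trans to <-trans; _≟_ to _≟ᶠ_; _<?_ to _<ᶠ?_)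
  open ≤ public using () renaming (refl to ≤-refl; trans to ≤-trans; antisym to ≤-antisym; _≤?_ to _≤ᶠ?_)

  ≤-<-trans : ∀ {x y z} → x ≤ y → y < z → x < z
  ≤-<-trans (inj₁ x<y) y<z = <-trans x<y y<z
  ≤-<-trans (inj₂ refl) y<z = y<z

  <-≤-trans : ∀ {x y z} → x < y → y ≤ z → x < z
  <-≤-trans x<y (inj₁ y<z) = <-trans x<y y<z
  <-≤-trans x<y (inj₂ refl) = x<y

  <⇒≱ : ∀ {x y} → x < y → ¬ y ≤ x
  <⇒≱ x<y y≤x = <-irrefl refl (<-≤-trans x<y y≤x)

  ≤-or-> : ∀ x y → x ≤ y ⊎ y < x
  ≤-or-> x y with compare x y
  ... | tri< x<y _ _ = inj₁ (inj₁ x<y)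
  ... | tri≈ _ x≡y _ = inj₁ (inj₂ x≡y)
  ... | tri> _ _ y<x = inj₂ y<x

  +-monoˡ-≤ : ∀ {x y} z → x ≤ y → x + z ≤ y + z
  +-monoˡ-≤ z (inj₁ x<y) = inj₁ (+-mono-< z x<y)
  +-monoˡ-≤ z (inj₂ refl) = inj₂ refl

  +-nonneg : ∀ {x y} → 0# ≤ x → 0# ≤ y → 0# ≤ x + y
  +-nonneg {x} {y} 0≤x 0≤y =
    ≤-trans 0≤y (subst (_≤ x + y) (+-identityˡ y) (+-monoˡ-≤ y 0≤x))

  +-pos-nonneg : ∀ {x y} → 0# < x → 0# ≤ y → 0# < x + y
  +-pos-nonneg {x} {y} 0<x 0≤y =
    ≤-<-trans 0≤y (subst (_< x + y) (+-identityˡ y) (+-mono-< y 0<x))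

  +-nonneg-pos : ∀ {x y} → 0# ≤ x → 0# < y → 0# < x + y
  +-nonneg-pos {x} {y} 0≤x 0<y = subst (0# <_) (+-comm y x) (+-pos-nonneg 0<y 0≤x)

  *-nonneg : ∀ {x y} → 0# ≤ x → 0# ≤ y → 0# ≤ x * y
  *-nonneg (inj₁ 0<x) (inj₁ 0<y) = inj₁ (*-pos 0<x 0<y)
  *-nonneg {x} _ (inj₂ refl) = inj₂ (sym (zeroʳ x))
  *-nonneg {y = y} (inj₂ refl) _ = inj₂ (sym (zeroˡ y))

  -- Reduces an inequality to a ring identity for the solver, once the difference e is exhibited as
  -- visibly nonnegative.
  x+e≡y⇒x≤y : ∀ {x y e} → 0# ≤ e → x + e ≡ y → x ≤ y
  x+e≡y⇒x≤y {x} {y} {e} 0≤e eq = subst₂ _≤_ (+-identityˡ x) (trans (+-comm e x) eq) (+-monoˡ-≤ x 0≤e)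

  x+e≡y⇒x<y : ∀ {x y e} → 0# < e → x + e ≡ y → x < y
  x+e≡y⇒x<y {x} {y} {e} 0<e eq = subst₂ _<_ (+-identityˡ x) (trans (+-comm e x) eq) (+-mono-< x 0<e)

  x≤y⇒0≤y-x : ∀ {x y} → x ≤ y → 0# ≤ y + - x
  x≤y⇒0≤y-x {x} x≤y = subst (_≤ _) (-‿inverseʳ x) (+-monoˡ-≤ (- x) x≤y)

  x<y⇒0<y-x : ∀ {x y} → x < y → 0# < y + - x
  x<y⇒0<y-x {x} x<y = subst (_< _) (-‿inverseʳ x) (+-mono-< (- x) x<y)

  x≤0⇒0≤-x : ∀ {x} → x ≤ 0# → 0# ≤ - x
  x≤0⇒0≤-x {x} x≤0 = subst (0# ≤_) (+-identityˡ (- x)) (x≤y⇒0≤y-x x≤0)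

  x<0⇒0<-x : ∀ {x} → x < 0# → 0# < - x
  x<0⇒0<-x {x} x<0 = subst (0# <_) (+-identityˡ (- x)) (x<y⇒0<y-x x<0)

  square-nonneg : ∀ x → 0# ≤ x * x
  square-nonneg x with ≤-or-> 0# x
  ... | inj₁ 0≤x = *-nonneg 0≤x 0≤x
  ... | inj₂ x<0 = subst (0# ≤_) (solve 1 (λ x → :- x :* :- x := x :* x) refl x)
                     (*-nonneg (inj₁ (x<0⇒0<-x x<0)) (inj₁ (x<0⇒0<-x x<0)))

  0<1 : 0# < 1#
  0<1 with subst (0# ≤_) (*-identityˡ 1#) (square-nonneg 1#)
  ... | inj₁ 0<1 = 0<1
  ... | inj₂ 0≡1 = contradiction 0≡1 0≢1

  pos⇒≢0 : ∀ {x} → 0# < x → x ≢ 0#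
  pos⇒≢0 0<x refl = <-irrefl refl 0<x

  nonneg∧≢0⇒pos : ∀ {x} → 0# ≤ x → x ≢ 0# → 0# < x
  nonneg∧≢0⇒pos (inj₁ 0<x) _ = 0<x
  nonneg∧≢0⇒pos (inj₂ 0≡x) x≢0 = contradiction (sym 0≡x) x≢0

  *-cancel-0 : ∀ {x y} → x ≢ 0# → x * y ≡ 0# → y ≡ 0#
  *-cancel-0 {x} {y} x≢0 xy≡0 with inverse x x≢0
  ... | i , xi≡1 = begin
    y              ≡⟨ sym (*-identityˡ y) ⟩
    1# * y         ≡⟨ cong (_* y) (sym xi≡1) ⟩
    x * i * y      ≡⟨ solve 3 (λ x i y → x :* i :* y := i :* (x :* y)) refl x i y ⟩
    i * (x * y)    ≡⟨ cong (i *_) xy≡0 ⟩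
    i * 0#         ≡⟨ zeroʳ i ⟩
    0#             ∎
    where open ≡-Reasoning

  inverse-pos : ∀ {x y} → 0# < x → x * y ≡ 1# → 0# < y
  inverse-pos {x} {y} 0<x xy≡1 with ≤-or-> y 0#
  ... | inj₂ 0<y = 0<y
  ... | inj₁ y≤0 = contradiction
    (subst (0# ≤_) (solve 2 (λ x y → x :* :- y := :- (x :* y)) refl x y)
      (*-nonneg (inj₁ 0<x) (x≤0⇒0≤-x y≤0)))
    (λ 0≤-xy → <⇒≱ 0<1 (x+e≡y⇒x≤y 0≤-xy (trans (cong (_+ - (x * y)) (sym xy≡1)) (-‿inverseʳ _))))

-- Finite sums, inner products and orthogonal projection.

module EuclideanSpace (R : RealField) where
  open OrderedField R

  opaque
    -- A sealed copy of `∑`, so that sums stay atoms during normalisation. `sum-suc` exposes the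
    -- recursion, and `sum≡∑` translates to and from the form used in the theorem.
    sum : ∀ {q} → (Fin q → Carrier) → Carrier
    sum = ∑ R

    sum-cong : ∀ {q} {f g : Fin q → Carrier} → f ≗ g → sum f ≡ sum g
    sum-cong {zero} f≗g = refl
    sum-cong {suc q} f≗g = cong₂ _+_ (f≗g zero) (sum-cong (f≗g ∘ suc))

    sum-zero : ∀ {q} {f : Fin q → Carrier} → (∀ i → f i ≡ 0#) → sum f ≡ 0#
    sum-zero {zero} _ = refl
    sum-zero {suc q} f≡0 = trans (cong₂ _+_ (f≡0 zero) (sum-zero (f≡0 ∘ suc))) (+-identityˡ 0#)

    sum-+ : ∀ {q} (f g : Fin q → Carrier) → sum (λ i → f i + g i) ≡ sum f + sum g
    sum-+ {zero} f g = sym (+-identityˡ 0#)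
    sum-+ {suc q} f g = trans (cong (f zero + g zero +_) (sum-+ (f ∘ suc) (g ∘ suc)))
      (solve 4 (λ a b c d → a :+ b :+ (c :+ d) := a :+ c :+ (b :+ d)) refl (f zero) (g zero) _ _)

    sum-*ˡ : ∀ {q} a (f : Fin q → Carrier) → sum (λ i → a * f i) ≡ a * sum f
    sum-*ˡ {zero} a f = sym (zeroʳ a)
    sum-*ˡ {suc q} a f = trans (cong (a * f zero +_) (sum-*ˡ a (f ∘ suc))) (sym (distribˡ a _ _))

    sum-swap : ∀ {q s} (f : Fin q → Fin s → Carrier) →
               sum (λ i → sum (f i)) ≡ sum (λ j → sum (λ i → f i j))
    sum-swap {zero} {s} f = sym (sum-zero {s} (λ _ → refl))
    sum-swap {suc q} f = trans (cong (sum (f zero) +_) (sum-swap (f ∘ suc))) (sym (sum-+ (f zero) _))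

    sum-punchIn : ∀ {q} (k : Fin (suc q)) (f : Fin (suc q) → Carrier) →
                  sum f ≡ f k + sum (f ∘ punchIn k)
    sum-punchIn zero f = refl
    sum-punchIn {suc q} (suc k) f = trans (cong (f zero +_) (sum-punchIn k (f ∘ suc)))
      (solve 3 (λ a b c → a :+ (b :+ c) := b :+ (a :+ c)) refl (f zero) (f (suc k)) _)

    sum-nonneg : ∀ {q} {f : Fin q → Carrier} → (∀ i → 0# ≤ f i) → 0# ≤ sum f
    sum-nonneg {zero} _ = ≤-refl
    sum-nonneg {suc q} 0≤f = +-nonneg (0≤f zero) (sum-nonneg (0≤f ∘ suc))

    sum-suc : ∀ {q} (f : Fin (suc q) → Carrier) → sum f ≡ f zero + sum (f ∘ suc)
    sum-suc f = refl

    sum≡∑ : ∀ {q} (f : Fin q → Carrier) → sum f ≡ ∑ R f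
    sum≡∑ f = refl

  sum-*ʳ : ∀ {q} a (f : Fin q → Carrier) → sum (λ i → f i * a) ≡ sum f * a
  sum-*ʳ a f = trans (sum-cong (λ i → *-comm (f i) a)) (trans (sum-*ˡ a f) (*-comm a _))

  sum-lin : ∀ {q} s t (a b : Fin q → Carrier) (g : Fin q → Carrier) →
            sum (λ i → (s * a i + t * b i) * g i) ≡ s * sum (λ i → a i * g i) + t * sum (λ i → b i * g i)
  sum-lin s t a b g = trans
    (sum-cong (λ i → solve 5 (λ s a t b g → (s :* a :+ t :* b) :* g := s :* (a :* g) :+ t :* (b :* g))
                       refl s (a i) t (b i) (g i)))
    (trans (sum-+ (λ i → s * (a i * g i)) (λ i → t * (b i * g i))) (cong₂ _+_ (sum-*ˡ s _) (sum-*ˡ t _)))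

  sum-nonneg≡0 : ∀ {q} {f : Fin q → Carrier} → (∀ i → 0# ≤ f i) → sum f ≡ 0# → ∀ i → f i ≡ 0#
  sum-nonneg≡0 {suc q} {f} 0≤f Σ≡0 i with 0≤f i
  ... | inj₂ 0≡fi = sym 0≡fi
  ... | inj₁ 0<fi = contradiction (trans (sym (sum-punchIn i f)) Σ≡0)
    (pos⇒≢0 (+-pos-nonneg 0<fi (sum-nonneg (0≤f ∘ punchIn i))))

  inner : ∀ {d} → Point R d → Point R d → Carrier
  inner x y = sum λ t → x t * y t

  norm² : ∀ {d} → Point R d → Carrier
  norm² x = inner x x

  comb : ∀ {d q} → (Fin q → Carrier) → (Fin q → Point R d) → Point R d
  comb c x t = sum λ i → c i * x i t

  inner-comm : ∀ {d} (x y : Point R d) → inner x y ≡ inner y x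
  inner-comm x y = sum-cong λ t → *-comm (x t) (y t)

  inner-cong : ∀ {d} {x x′ y y′ : Point R d} → x ≗ x′ → y ≗ y′ → inner x y ≡ inner x′ y′
  inner-cong x≗x′ y≗y′ = sum-cong λ t → cong₂ _*_ (x≗x′ t) (y≗y′ t)

  inner-+ : ∀ {d} (x y z : Point R d) → inner (λ t → x t + y t) z ≡ inner x z + inner y z
  inner-+ x y z = trans (sum-cong (λ t → distribʳ (z t) (x t) (y t))) (sum-+ _ _)

  inner-combʳ : ∀ {d q} (y : Point R d) (c : Fin q → Carrier) (x : Fin q → Point R d) →
                inner y (comb c x) ≡ sum λ i → c i * inner y (x i)
  inner-combʳ y c x = begin
    sum (λ t → y t * sum (λ i → c i * x i t))
      ≡⟨ sum-cong (λ t → trans (sym (sum-*ˡ (y t) _))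
           (sum-cong λ i → solve 3 (λ y c x → y :* (c :* x) := c :* (y :* x)) refl (y t) (c i) (x i t))) ⟩
    sum (λ t → sum (λ i → c i * (y t * x i t)))
      ≡⟨ sum-swap (λ t i → c i * (y t * x i t)) ⟩
    sum (λ i → sum (λ t → c i * (y t * x i t)))
      ≡⟨ sum-cong (λ i → sum-*ˡ (c i) _) ⟩
    sum (λ i → c i * inner y (x i)) ∎
    where open ≡-Reasoning

  inner-lin : ∀ {d q} s t (a b : Fin q → Carrier) (x : Fin q → Point R d) (y : Point R d) →
              inner y (comb (λ i → s * a i + t * b i) x) ≡ s * inner y (comb a x) + t * inner y (comb b x)
  inner-lin s t a b x y = trans (inner-combʳ y _ x) (trans (sum-lin s t a b _)
    (sym (cong₂ (λ A B → s * A + t * B) (inner-combʳ y a x) (inner-combʳ y b x))))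

  norm²-nonneg : ∀ {d} (x : Point R d) → 0# ≤ norm² x
  norm²-nonneg x = sum-nonneg λ t → square-nonneg (x t)

  norm²≡0⇒≡0 : ∀ {d} (x : Point R d) → norm² x ≡ 0# → ∀ t → x t ≡ 0#
  norm²≡0⇒≡0 x xx≡0 t with x t ≟ᶠ 0#
  ... | yes xt≡0 = xt≡0
  ... | no xt≢0 = *-cancel-0 xt≢0 (sum-nonneg≡0 (λ t → square-nonneg (x t)) xx≡0 t)

  inner-zeroˡ : ∀ {d} {x : Point R d} (y : Point R d) → (∀ t → x t ≡ 0#) → inner x y ≡ 0#
  inner-zeroˡ y x≡0 = sum-zero λ t → trans (cong (_* y t) (x≡0 t)) (zeroˡ (y t))

  _⊖_ : ∀ {d} → Point R d → Point R d → Point R d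
  (x ⊖ y) t = x t + - y t

  inner-⊖ : ∀ {d} (x y z : Point R d) → inner (x ⊖ y) z ≡ inner x z + - inner y z
  inner-⊖ x y z = trans (inner-+ x (λ t → - y t) z) (cong (inner x z +_)
    (trans (sum-cong λ t → solve 2 (λ y z → :- y :* z := :- one :* (y :* z)) refl (y t) (z t))
      (trans (sum-*ˡ (- 1#) _) (solve 1 (λ a → :- one :* a := :- a) refl (inner y z)))))

  norm²-⊖ : ∀ {d} (x y : Point R d) → norm² (x ⊖ y) ≡ norm² x + - inner x y + (- inner x y + norm² y)
  norm²-⊖ x y = begin
    inner (x ⊖ y) (x ⊖ y)                       ≡⟨ inner-⊖ x y (x ⊖ y) ⟩
    inner x (x ⊖ y) + - inner y (x ⊖ y)         ≡⟨ cong₂ (λ a b → a + - b) (flip x) (flip y) ⟩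
    norm² x + - inner y x + - (inner x y + - norm² y)
      ≡⟨ cong (λ e → norm² x + - e + - (inner x y + - norm² y)) (inner-comm y x) ⟩
    norm² x + - inner x y + - (inner x y + - norm² y)
      ≡⟨ solve 3 (λ a b c → a :+ :- b :+ :- (b :+ :- c) := a :+ :- b :+ (:- b :+ c)) refl _ _ _ ⟩
    norm² x + - inner x y + (- inner x y + norm² y) ∎
    where
    open ≡-Reasoning
    flip : ∀ z → inner z (x ⊖ y) ≡ inner x z + - inner y z
    flip z = trans (inner-comm z (x ⊖ y)) (inner-⊖ x y z)

  -- Gram-Schmidt as a recursion: u and s are the parts of `w zero` and z orthogonal to the
  -- remaining vectors, and the component of s along u is then removed. The vectors `w j` may be
  -- linearly dependent.
  project : ∀ {d} q (w : Fin q → Point R d) (z : Point R d) →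
            ∃ λ a → ∀ j → inner (λ t → z t + comb a w t) (w j) ≡ 0#
  project zero w z = (λ ()) , λ ()
  project {d} (suc q) w z with project q (w ∘ suc) (w zero) | project q (w ∘ suc) z
  ... | a₀ , u⊥w | a , s⊥w = a* , orthogonal
    where
    open ≡-Reasoning
    u s : Point R d
    u t = w zero t + comb a₀ (w ∘ suc) t
    s t = z t + comb a (w ∘ suc) t

    ⊥comb : ∀ {r} b → (∀ j → inner r (w (suc j)) ≡ 0#) → inner r (comb b (w ∘ suc)) ≡ 0#
    ⊥comb {r} b r⊥w = trans (inner-combʳ r b (w ∘ suc))
      (sum-zero λ j → trans (cong (b j *_) (r⊥w j)) (zeroʳ (b j)))

    -- u differs from `w zero` by a combination of vectors to which r is orthogonal.
    inner-u : ∀ {r} → (∀ j → inner r (w (suc j)) ≡ 0#) → inner r u ≡ inner r (w zero)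
    inner-u {r} r⊥w = begin
      inner r u           ≡⟨ inner-comm r u ⟩
      inner u r           ≡⟨ inner-+ (w zero) (comb a₀ (w ∘ suc)) r ⟩
      inner (w zero) r + inner (comb a₀ (w ∘ suc)) r
        ≡⟨ cong₂ _+_ (inner-comm (w zero) r) (trans (inner-comm _ r) (⊥comb a₀ r⊥w)) ⟩
      inner r (w zero) + 0# ≡⟨ +-identityʳ _ ⟩
      inner r (w zero)      ∎

    step : ∃ λ τ → inner s u + τ * norm² u ≡ 0#
    step with norm² u ≟ᶠ 0#
    -- Here u = 0, so s is already orthogonal to it and there is no component to remove.
    ... | yes uu≡0 = 0# , trans (cong (inner s u +_) (zeroˡ _)) (trans (+-identityʳ _)
            (trans (inner-comm s u) (inner-zeroˡ s (norm²≡0⇒≡0 u uu≡0))))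
    ... | no uu≢0 with inverse (norm² u) uu≢0
    ...   | i , uu*i≡1 = - (inner s u * i) , (begin
            inner s u + - (inner s u * i) * norm² u
              ≡⟨ solve 3 (λ su i uu → su :+ :- (su :* i) :* uu := su :+ :- su :* (uu :* i)) refl _ i _ ⟩
            inner s u + - inner s u * (norm² u * i)
              ≡⟨ cong (λ e → inner s u + - inner s u * e) uu*i≡1 ⟩
            inner s u + - inner s u * 1#
              ≡⟨ solve 1 (λ a → a :+ :- a :* one := nil) refl _ ⟩
            0# ∎)
    τ = proj₁ step

    -- The coefficients for which z + `comb a* w` is s + τ u.
    a* : Fin (suc q) → Carrier
    a* = cons τ (λ j → 1# * a j + τ * a₀ j)

    residual : ∀ y → inner (λ t → z t + comb a* w t) y ≡ inner s y + τ * inner u y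
    residual y = begin
      inner (λ t → z t + comb a* w t) y
        ≡⟨ inner-+ z (comb a* w) y ⟩
      inner z y + inner (comb a* w) y
        ≡⟨ cong (inner z y +_) (trans (inner-comm _ y) (trans (inner-combʳ y a* w) (sum-suc _))) ⟩
      inner z y + (τ * inner y (w zero) + sum (λ j → (1# * a j + τ * a₀ j) * inner y (w (suc j))))
        ≡⟨ cong (λ e → inner z y + (τ * inner y (w zero) + e)) (sum-lin 1# τ a a₀ _) ⟩
      inner z y + (τ * inner y (w zero) + (1# * sum (λ j → a j * inner y (w (suc j))) + τ * sum (λ j → a₀ j * inner y (w (suc j)))))
        ≡⟨ cong₂ (λ A B → inner z y + (τ * inner y (w zero) + (1# * A + τ * B)))
             (sym (trans (inner-comm _ y) (inner-combʳ y a (w ∘ suc))))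
             (sym (trans (inner-comm _ y) (inner-combʳ y a₀ (w ∘ suc)))) ⟩
      inner z y + (τ * inner y (w zero) + (1# * inner (comb a (w ∘ suc)) y + τ * inner (comb a₀ (w ∘ suc)) y))
        ≡⟨ solve 5 (λ Z T W A B → Z :+ (T :* W :+ (one :* A :+ T :* B)) := (Z :+ A) :+ T :* (W :+ B))
             refl _ τ _ _ _ ⟩
      (inner z y + inner (comb a (w ∘ suc)) y) + τ * (inner y (w zero) + inner (comb a₀ (w ∘ suc)) y)
        ≡⟨ cong₂ (λ A B → A + τ * B) (sym (inner-+ z _ y))
             (trans (cong (_+ inner (comb a₀ (w ∘ suc)) y) (inner-comm y (w zero))) (sym (inner-+ (w zero) _ y))) ⟩
      inner s y + τ * inner u y ∎

    orthogonal : ∀ j → inner (λ t → z t + comb a* w t) (w j) ≡ 0#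
    orthogonal zero = trans (residual (w zero)) (trans
      (sym (cong₂ (λ A B → A + τ * B) (inner-u s⊥w) (inner-u u⊥w))) (proj₂ step))
    orthogonal (suc j) = trans (residual (w (suc j))) (trans
      (cong₂ (λ A B → A + τ * B) (s⊥w j) (u⊥w j)) (trans (+-identityˡ _) (zeroʳ τ)))

  average : ∀ {d q} {y : Point R d} {ν} (c : Fin q → Carrier) (x : Fin q → Point R d) →
            sum c ≡ 1# → (∀ i → inner y (x i) ≡ ν) → inner y (comb c x) ≡ ν
  average {y = y} {ν} c x Σc≡1 h = begin
    inner y (comb c x)              ≡⟨ inner-combʳ y c x ⟩
    sum (λ i → c i * inner y (x i)) ≡⟨ sum-cong (λ i → cong (c i *_) (h i)) ⟩
    sum (λ i → c i * ν)             ≡⟨ sum-*ʳ ν c ⟩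
    sum c * ν                       ≡⟨ cong (_* ν) Σc≡1 ⟩
    1# * ν                          ≡⟨ *-identityˡ ν ⟩
    ν                               ∎
    where open ≡-Reasoning

  -- The foot of the perpendicular from the origin to the affine hull: project `x zero` against the
  -- differences `x (suc j) ⊖ x zero`. Orthogonality makes the inner product with the foot constant
  -- on the points, and averaging with b identifies the constant. The weights b may be negative.
  affine-nearest : ∀ {d q} (x : Fin (suc q) → Point R d) →
                   ∃ λ b → sum b ≡ 1# × (∀ i → inner (comb b x) (x i) ≡ norm² (comb b x))
  affine-nearest {d} {q} x with project q (λ j → x (suc j) ⊖ x zero) (x zero)
  ... | a , ⊥w = b , Σb≡1 , λ i → trans (constant i) (sym (average b x Σb≡1 constant))
    where
    open ≡-Reasoning
    b : Fin (suc q) → Carrier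
    b = cons (1# + - sum a) a

    Σb≡1 : sum b ≡ 1#
    Σb≡1 = trans (sum-suc b) (solve 1 (λ s → one :+ :- s :+ s := one) refl (sum a))

    y≗r : ∀ t → comb b x t ≡ x zero t + comb a (λ j → x (suc j) ⊖ x zero) t
    y≗r t = sym (begin
      x₀ + sum (λ j → a j * (x (suc j) t + - x₀))
        ≡⟨ cong (x₀ +_) (sum-cong λ j → distribˡ (a j) _ _) ⟩
      x₀ + sum (λ j → a j * x (suc j) t + a j * - x₀)
        ≡⟨ cong (x₀ +_) (trans (sum-+ _ _) (cong (sum (λ j → a j * x (suc j) t) +_) (sum-*ʳ (- x₀) a))) ⟩
      x₀ + (sum (λ j → a j * x (suc j) t) + sum a * - x₀)
        ≡⟨ solve 3 (λ x m s → x :+ (m :+ s :* :- x) := (one :+ :- s) :* x :+ m) refl x₀ _ (sum a) ⟩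
      (1# + - sum a) * x₀ + sum (λ j → a j * x (suc j) t)
        ≡⟨ sym (sum-suc _) ⟩
      comb b x t ∎)
      where x₀ = x zero t

    constant : ∀ i → inner (comb b x) (x i) ≡ inner (comb b x) (x zero)
    constant zero = refl
    constant (suc j) = begin
      inner y (x (suc j))
        ≡⟨ solve 2 (λ a b → a := a :+ :- b :+ b) refl _ (inner y (x zero)) ⟩
      inner y (x (suc j)) + - inner y (x zero) + inner y (x zero)
        ≡⟨ cong (_+ inner y (x zero)) (begin
             inner y (x (suc j)) + - inner y (x zero)
               ≡⟨ cong₂ (λ A B → A + - B) (inner-comm y _) (inner-comm y _) ⟩
             inner (x (suc j)) y + - inner (x zero) y
               ≡⟨ sym (inner-⊖ (x (suc j)) (x zero) y) ⟩
             inner (x (suc j) ⊖ x zero) y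
               ≡⟨ inner-comm _ y ⟩
             inner y (x (suc j) ⊖ x zero)
               ≡⟨ inner-cong y≗r (λ _ → refl) ⟩
             _
               ≡⟨ ⊥w j ⟩
             0# ∎) ⟩
      0# + inner y (x zero)
        ≡⟨ +-identityˡ _ ⟩
      inner y (x zero) ∎
      where
      y = comb b x

-- Finite minima, the ratio test and linear dependence.

module ConvexHull (R : RealField) where
  open OrderedField R
  open EuclideanSpace R
  open ≡-Reasoning

  punchIn-elim : ∀ {q} {P : Fin (suc q) → Set} (k : Fin (suc q)) →
                 P k → (∀ j → P (punchIn k j)) → ∀ i → P i
  punchIn-elim {P = P} k Pk Pj i with k Fin.≟ i
  ... | yes refl = Pk
  ... | no k≢i = subst P (punchIn-punchOut k≢i) (Pj (punchOut k≢i))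

  argmin : ∀ {q} (f : Fin q → Carrier) {P : Fin q → Set} → (∀ i → Dec (P i)) → ∃ P →
           ∃ λ j → P j × (∀ i → P i → f j ≤ f i)
  argmin {suc q} f {P} P? (i , Pi) with any? (P? ∘ suc)
  ... | no ¬tail = zero , head i Pi , λ where
      zero _ → ≤-refl
      (suc k) Pk → contradiction (k , Pk) ¬tail
    where
    head : ∀ i → P i → P zero
    head zero Pi = Pi
    head (suc k) Pk = contradiction (k , Pk) ¬tail
  ... | yes tail with argmin (f ∘ suc) (P? ∘ suc) tail | P? zero
  ...   | j , Pj , min | no ¬Pz = suc j , Pj , λ where
      zero Pz → contradiction Pz ¬Pz
      (suc k) Pk → min k Pk
  ...   | j , Pj , min | yes Pz with ≤-or-> (f zero) (f (suc j))
  ...     | inj₁ z≤j = zero , Pz , λ where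
      zero _ → ≤-refl
      (suc k) Pk → ≤-trans z≤j (min k Pk)
  ...     | inj₂ j<z = suc j , Pj , λ where
      zero _ → inj₁ j<z
      (suc k) Pk → min k Pk

  -- Total, with value 0 at 0, so that `ratio-test` can form its quotients for every index; the
  -- search for a minimum then compares only those with a negative denominator entry `a i`.
  recip : Carrier → Carrier
  recip x with x ≟ᶠ 0#
  ... | yes _ = 0#
  ... | no x≢0 = proj₁ (inverse x x≢0)

  recip-inverse : ∀ {x} → x ≢ 0# → x * recip x ≡ 1#
  recip-inverse {x} x≢0 with x ≟ᶠ 0#
  ... | yes x≡0 = contradiction x≡0 x≢0
  ... | no x≢0′ = proj₂ (inverse x x≢0′)

  -- The ratio test of the simplex method: t is the least `c i` / (- `a i`) over the indices with
  -- `a i` < 0, and an index attaining it is the j whose entry becomes 0.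
  ratio-test : ∀ {q} (c a : Fin q → Carrier) → (∀ i → 0# ≤ c i) → (∃ λ i → a i < 0#) →
               ∃ λ t → 0# ≤ t × (∀ i → 0# ≤ c i + t * a i) × ∃ λ j → c j + t * a j ≡ 0#
  ratio-test c a 0≤c neg with argmin (λ i → c i * recip (- a i)) (λ i → a i <ᶠ? 0#) neg
  ... | j , aj<0 , min = ratio j , ratio-nonneg aj<0 , nonneg , j , exact
    where
    ratio : _ → Carrier
    ratio i = c i * recip (- a i)

    recip-spec : ∀ {i} → a i < 0# → - a i * recip (- a i) ≡ 1#
    recip-spec ai<0 = recip-inverse (pos⇒≢0 (x<0⇒0<-x ai<0))

    ratio-nonneg : ∀ {i} → a i < 0# → 0# ≤ ratio i
    ratio-nonneg {i} ai<0 = *-nonneg (0≤c i) (inj₁ (inverse-pos (x<0⇒0<-x ai<0) (recip-spec ai<0)))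

    rescale : ∀ {i} → a i < 0# → ratio i * - a i ≡ c i
    rescale {i} ai<0 = begin
      c i * recip (- a i) * - a i
        ≡⟨ solve 3 (λ c r a → c :* r :* a := c :* (a :* r)) refl (c i) (recip (- a i)) (- a i) ⟩
      c i * (- a i * recip (- a i)) ≡⟨ cong (c i *_) (recip-spec ai<0) ⟩
      c i * 1#                      ≡⟨ *-identityʳ (c i) ⟩
      c i                           ∎

    shift : ∀ {i} t → a i < 0# → (ratio i + - t) * - a i ≡ c i + t * a i
    shift {i} t ai<0 = trans
      (solve 3 (λ r t a → (r :+ :- t) :* :- a := r :* :- a :+ t :* a) refl (ratio i) t (a i))
      (cong (_+ t * a i) (rescale ai<0))

    nonneg : ∀ i → 0# ≤ c i + ratio j * a i
    nonneg i with ≤-or-> 0# (a i)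
    ... | inj₁ 0≤ai = +-nonneg (0≤c i) (*-nonneg (ratio-nonneg aj<0) 0≤ai)
    ... | inj₂ ai<0 = subst (0# ≤_) (shift (ratio j) ai<0)
      (*-nonneg (x≤y⇒0≤y-x (min i ai<0)) (inj₁ (x<0⇒0<-x ai<0)))

    exact : c j + ratio j * a j ≡ 0#
    exact = trans (sym (shift (ratio j) aj<0))
      (solve 2 (λ r a → (r :+ :- r) :* a := nil) refl (ratio j) (- a j))

  -- Gaussian elimination: clear the first coordinate with a vector x k for which it is nonzero.
  dependent : ∀ d (x : Fin (suc d) → Point R d) →
              ∃ λ a → (∃ λ i → a i ≢ 0#) × (∀ t → comb a x t ≡ 0#)
  dependent zero x = (λ _ → 1#) , (zero , 0≢1 ∘ sym) , λ ()
  dependent (suc d) x with any? (λ i → ¬? (x i zero ≟ᶠ 0#))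
  ... | no flat with dependent d (λ i t → x (suc i) (suc t))
  ...   | a , (i , ai≢0) , rel = cons 0# a , (suc i , ai≢0) , λ where
      zero → sum-zero λ i → trans (cong (cons 0# a i *_) (x₀≡0 i)) (zeroʳ _)
      (suc t) → trans (sum-suc _) (trans (cong₂ _+_ (zeroˡ _) (rel t)) (+-identityˡ 0#))
    where
    x₀≡0 : ∀ i → x i zero ≡ 0#
    x₀≡0 i = decidable-stable (x i zero ≟ᶠ 0#) λ x≢0 → flat (i , x≢0)
  dependent (suc d) x | yes (k , xk≢0) with dependent d
    (λ j t → x (punchIn k j) (suc t) + - (x (punchIn k j) zero * recip (x k zero)) * x k (suc t))
  ... | a , (i , ai≢0) , rel =
    insertAt a k α , (punchIn k i , λ e → ai≢0 (trans (sym (insertAt-punchIn a k α i)) e)) ,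
    λ t → trans (reduce t) (vanish t)
    where
    factor : Fin (suc d) → Carrier
    factor j = x (punchIn k j) zero * recip (x k zero)

    -- Subtracting `factor j` times `x k` from each other vector amounts, in the original family, to
    -- giving `x k` this weight.
    α : Carrier
    α = - sum (λ j → a j * factor j)

    eliminated : Fin (suc d) → Point R (suc d)
    eliminated j t = x (punchIn k j) t + - factor j * x k t

    reduce : ∀ t → comb (insertAt a k α) x t ≡ comb a eliminated t
    reduce t = begin
      comb (insertAt a k α) x t
        ≡⟨ sum-punchIn k _ ⟩
      insertAt a k α k * x k t + sum (λ j → insertAt a k α (punchIn k j) * x (punchIn k j) t)
        ≡⟨ cong₂ (λ A B → A * x k t + B) (insertAt-lookup a k α)
             (sum-cong λ j → cong (_* x (punchIn k j) t) (insertAt-punchIn a k α j)) ⟩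
      α * x k t + sum (λ j → a j * x (punchIn k j) t)
        ≡⟨ solve 3 (λ s X m → :- s :* X :+ m := m :+ s :* :- X) refl (sum (λ j → a j * factor j)) (x k t) _ ⟩
      sum (λ j → a j * x (punchIn k j) t) + sum (λ j → a j * factor j) * - x k t
        ≡⟨ cong (sum (λ j → a j * x (punchIn k j) t) +_) (sym (sum-*ʳ (- x k t) _)) ⟩
      sum (λ j → a j * x (punchIn k j) t) + sum (λ j → a j * factor j * - x k t)
        ≡⟨ sym (sum-+ _ _) ⟩
      sum (λ j → a j * x (punchIn k j) t + a j * factor j * - x k t)
        ≡⟨ sum-cong (λ j → solve 4 (λ a X f Y → a :* X :+ a :* f :* :- Y := a :* (X :+ :- f :* Y)) refl
             (a j) (x (punchIn k j) t) (factor j) (x k t)) ⟩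
      comb a eliminated t ∎

    vanish : ∀ t → comb a eliminated t ≡ 0#
    vanish (suc t) = rel t
    vanish zero = sum-zero λ j → begin
      a j * (x (punchIn k j) zero + - (x (punchIn k j) zero * recip (x k zero)) * x k zero)
        ≡⟨ solve 4 (λ a X r Y → a :* (X :+ :- (X :* r) :* Y) := a :* (X :+ :- X :* (Y :* r))) refl
             (a j) (x (punchIn k j) zero) (recip (x k zero)) (x k zero) ⟩
      a j * (x (punchIn k j) zero + - x (punchIn k j) zero * (x k zero * recip (x k zero)))
        ≡⟨ cong (λ e → a j * (x (punchIn k j) zero + - x (punchIn k j) zero * e)) (recip-inverse xk≢0) ⟩
      a j * (x (punchIn k j) zero + - x (punchIn k j) zero * 1#)
        ≡⟨ solve 2 (λ a X → a :* (X :+ :- X :* one) := nil) refl (a j) (x (punchIn k j) zero) ⟩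
      0# ∎

  -- Nearest points of convex hulls and Carathéodory's theorem.

  Weights : ∀ {q} → (Fin q → Carrier) → Set
  Weights c = (∀ i → 0# ≤ c i) × sum c ≡ 1#

  -- The variational inequality, checked only at the finitely many generating points. It says that
  -- the hyperplane through p with normal p supports the hull; `nearest-minimal` recovers minimality
  -- of the norm.
  IsNearest : ∀ {d q} → (Fin q → Point R d) → (Fin q → Carrier) → Set
  IsNearest x c = Weights c × (∀ i → norm² (comb c x) ≤ inner (comb c x) (x i))

  sum-mix : ∀ {q} s t (a b : Fin q → Carrier) → sum (λ i → s * a i + t * b i) ≡ s * sum a + t * sum b
  sum-mix s t a b = trans (sum-+ _ _) (cong₂ _+_ (sum-*ˡ s a) (sum-*ˡ t b))

  sum-insertAt : ∀ {q} (c : Fin q → Carrier) k v → sum (insertAt c k v) ≡ v + sum c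
  sum-insertAt c k v = trans (sum-punchIn k _)
    (cong₂ _+_ (insertAt-lookup c k v) (sum-cong (insertAt-punchIn c k v)))

  comb-insertAt : ∀ {d q} (c : Fin q → Carrier) k v (x : Fin (suc q) → Point R d) t →
                  comb (insertAt c k v) x t ≡ v * x k t + comb c (x ∘ punchIn k) t
  comb-insertAt c k v x t = trans (sum-punchIn k _)
    (cong₂ _+_ (cong (_* x k t) (insertAt-lookup c k v))
      (sum-cong λ j → cong (_* x (punchIn k j) t) (insertAt-punchIn c k v j)))

  insertAt-nonneg : ∀ {q} {c : Fin q → Carrier} k {v} → 0# ≤ v → (∀ i → 0# ≤ c i) →
                    ∀ i → 0# ≤ insertAt c k v i
  insertAt-nonneg {c = c} k {v} 0≤v 0≤c = punchIn-elim k
    (subst (0# ≤_) (sym (insertAt-lookup c k v)) 0≤v)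
    (λ j → subst (0# ≤_) (sym (insertAt-punchIn c k v j)) (0≤c j))

  punchIn-Weights : ∀ {q} {c : Fin (suc q) → Carrier} j → c j ≡ 0# → Weights c → Weights (c ∘ punchIn j)
  punchIn-Weights {c = c} j cj≡0 (0≤c , Σc≡1) = 0≤c ∘ punchIn j ,
    trans (sym (trans (sum-punchIn j c) (trans (cong (_+ sum (c ∘ punchIn j)) cj≡0) (+-identityˡ _)))) Σc≡1

  comb-punchIn : ∀ {d q} {c : Fin (suc q) → Carrier} j → c j ≡ 0# → (x : Fin (suc q) → Point R d) →
                 ∀ t → comb c x t ≡ comb (c ∘ punchIn j) (x ∘ punchIn j) t
  comb-punchIn {c = c} j cj≡0 x t = trans (sum-punchIn j _)
    (trans (cong (_+ comb (c ∘ punchIn j) (x ∘ punchIn j) t) (trans (cong (_* x j t) cj≡0) (zeroˡ _)))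
      (+-identityˡ _))

  excess : ∀ {d q} (y : Point R d) ν (c : Fin q → Carrier) (x : Fin q → Point R d) → sum c ≡ 1# →
           sum (λ i → c i * (inner y (x i) + - ν)) ≡ inner y (comb c x) + - ν
  excess y ν c x Σc≡1 = begin
    sum (λ i → c i * (inner y (x i) + - ν))
      ≡⟨ sum-cong (λ i → distribˡ (c i) _ _) ⟩
    sum (λ i → c i * inner y (x i) + c i * - ν)
      ≡⟨ sum-+ _ _ ⟩
    sum (λ i → c i * inner y (x i)) + sum (λ i → c i * - ν)
      ≡⟨ cong₂ _+_ (sym (inner-combʳ y c x)) (trans (sum-*ʳ (- ν) c) (cong (_* - ν) Σc≡1)) ⟩
    inner y (comb c x) + 1# * - ν
      ≡⟨ cong (inner y (comb c x) +_) (*-identityˡ (- ν)) ⟩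
    inner y (comb c x) + - ν ∎

  average-≥ : ∀ {d q} {y : Point R d} {ν} {c : Fin q → Carrier} (x : Fin q → Point R d) →
              Weights c → (∀ i → ν ≤ inner y (x i)) → ν ≤ inner y (comb c x)
  average-≥ {y = y} {ν} {c} x (0≤c , Σc≡1) h = x+e≡y⇒x≤y
    (sum-nonneg λ i → *-nonneg (0≤c i) (x≤y⇒0≤y-x (h i)))
    (trans (cong (ν +_) (excess y ν c x Σc≡1))
      (solve 2 (λ ν e → ν :+ (e :+ :- ν) := e) refl ν (inner y (comb c x))))

  -- ‖z‖² - ‖p‖² = 2 (⟨p, z⟩ - ‖p‖²) + ‖p - z‖².
  norm²≤inner⇒norm²-≤ : ∀ {d} (p z : Point R d) → norm² p ≤ inner p z → norm² p ≤ norm² z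
  norm²≤inner⇒norm²-≤ p z pp≤pz = x+e≡y⇒x≤y
    (+-nonneg (+-nonneg (x≤y⇒0≤y-x pp≤pz) (x≤y⇒0≤y-x pp≤pz)) (norm²-nonneg (p ⊖ z)))
    (trans (cong (λ e → norm² p + (inner p z + - norm² p + (inner p z + - norm² p) + e)) (norm²-⊖ p z))
      (solve 3 (λ a b c → a :+ (b :+ :- a :+ (b :+ :- a) :+ (a :+ :- b :+ (:- b :+ c))) := c) refl _ _ _))

  nearest-minimal : ∀ {d q} {x : Fin q → Point R d} {c c′ : Fin q → Carrier} → IsNearest x c → Weights c′ →
                    norm² (comb c x) ≤ norm² (comb c′ x)
  nearest-minimal {x = x} {c} {c′} (_ , pp≤px) wc′ =
    norm²≤inner⇒norm²-≤ (comb c x) (comb c′ x) (average-≥ x wc′ pp≤px)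

  norm²-mix : ∀ {d} s t (p v : Point R d) →
              norm² (λ i → s * p i + t * v i) ≡
              s * (s * norm² p + t * inner p v) + t * (s * inner p v + t * norm² v)
  norm²-mix s t p v = trans (sum-lin s t p v _) (cong₂ (λ A B → s * A + t * B)
    (trans (inner-comm p _) (trans (sum-lin s t p v p) (cong (λ e → s * norm² p + t * e) (inner-comm v p))))
    (trans (inner-comm v _) (sum-lin s t p v v)))

  -- Moving from p towards v brings one closer to the origin at first; the step t = α / (α + β)
  -- with α = ⟨p, p − v⟩ and β = ‖v − p‖² is short enough.
  move-closer : ∀ {d} (p v : Point R d) → inner p v < norm² p →
                ∃ λ s → ∃ λ t → 0# ≤ s × 0# ≤ t × t + s ≡ 1# × norm² (λ i → s * p i + t * v i) < norm² p
  move-closer p v pv<pp = β * i , α * i , *-nonneg 0≤β (inj₁ 0<i) , inj₁ 0<t ,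
    trans (sym (distribʳ i α β)) αβi≡1 ,
    -- For t (α + β) = α and s = 1 - t, the squared norm drops by exactly t α (1 + t).
    x+e≡y⇒x<y (*-pos (*-pos 0<t 0<α) (+-pos-nonneg 0<1 (inj₁ 0<t))) (begin
      norm² (λ j → β * i * p j + α * i * v j) + α * i * α * (1# + α * i)
        ≡⟨ cong₂ (λ N o → N + α * i * α * (o + α * i)) (norm²-mix (β * i) (α * i) p v) (sym αβi≡1) ⟩
      _ ≡⟨ solve 4 (λ A B C i →
             let α = A :+ :- B
                 β = A :+ :- B :+ (:- B :+ C)
                 s = β :* i
                 t = α :* i
             in s :* (s :* A :+ t :* B) :+ t :* (s :* B :+ t :* C) :+ t :* α :* ((α :+ β) :* i :+ t)
                := (α :+ β) :* i :* ((α :+ β) :* i) :* A) refl (norm² p) (inner p v) (norm² v) i ⟩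
      (α + β) * i * ((α + β) * i) * norm² p
        ≡⟨ cong (λ o → o * o * norm² p) αβi≡1 ⟩
      1# * 1# * norm² p
        ≡⟨ solve 1 (λ a → one :* one :* a := a) refl (norm² p) ⟩
      norm² p ∎)
    where
    α β : Carrier
    α = norm² p + - inner p v
    β = norm² p + - inner p v + (- inner p v + norm² v)
    0<α : 0# < α
    0<α = x<y⇒0<y-x pv<pp
    0≤β : 0# ≤ β
    0≤β = subst (0# ≤_) (norm²-⊖ p v) (norm²-nonneg (p ⊖ v))
    0<α+β : 0# < α + β
    0<α+β = +-pos-nonneg 0<α 0≤β
    i : Carrier
    i = recip (α + β)
    αβi≡1 : (α + β) * i ≡ 1#
    αβi≡1 = recip-inverse (pos⇒≢0 0<α+β)
    0<i : 0# < i
    0<i = inverse-pos 0<α+β αβi≡1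
    0<t : 0# < α * i
    0<t = *-pos 0<α 0<i

  -- Walk from the weights c towards the affine minimiser b until a weight vanishes.
  retract : ∀ {d q} (x : Fin q → Point R d) (b c : Fin q → Carrier) →
            sum b ≡ 1# → (∀ i → inner (comb b x) (x i) ≡ norm² (comb b x)) →
            Weights c → (∃ λ i → b i < 0#) →
            ∃ λ c′ → Weights c′ × (∃ λ j → c′ j ≡ 0#) × norm² (comb c′ x) ≤ norm² (comb c x)
  retract {d} {q} x b c Σb≡1 b-affine wc@(0≤c , Σc≡1) (i , bi<0)
    with ratio-test c (λ i → b i + - c i) 0≤c
           (i , x+e≡y⇒x<y (+-nonneg-pos (0≤c i) (x<0⇒0<-x bi<0))
             (solve 2 (λ b c → b :+ :- c :+ (c :+ :- b) := nil) refl (b i) (c i)))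
  ... | t , 0≤t , nonneg , j , exact = c′ , (0≤c′ , Σc′≡1) , (j , trans (sym (same j)) exact) , closer
    where
    s : Carrier
    s = 1# + - t

    c′ : Fin q → Carrier
    c′ i = s * c i + t * b i

    same : ∀ i → c i + t * (b i + - c i) ≡ c′ i
    same i = solve 3 (λ c t b → c :+ t :* (b :+ :- c) := (one :+ :- t) :* c :+ t :* b) refl (c i) t (b i)

    0≤c′ : ∀ i → 0# ≤ c′ i
    0≤c′ i = subst (0# ≤_) (same i) (nonneg i)

    Σc′≡1 : sum c′ ≡ 1#
    Σc′≡1 = trans (sum-mix s t c b) (trans (cong₂ (λ A B → s * A + t * B) Σc≡1 Σb≡1)
      (solve 1 (λ t → (one :+ :- t) :* one :+ t :* one := one) refl t))

    -- The walk stops before passing b: for t > 1 the entry at an index with `b i` < 0 would be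
    -- negative.
    0≤s : 0# ≤ s
    0≤s with ≤-or-> t 1#
    ... | inj₁ t≤1 = x≤y⇒0≤y-x t≤1
    ... | inj₂ 1<t = contradiction (nonneg i) (<⇒≱ (x+e≡y⇒x<y
      (+-pos-nonneg (*-pos (<-trans 0<1 1<t) (x<0⇒0<-x bi<0)) (*-nonneg (inj₁ (x<y⇒0<y-x 1<t)) (0≤c i)))
      (solve 3 (λ c t b → c :+ t :* (b :+ :- c) :+ (t :* :- b :+ (t :+ :- one) :* c) := nil) refl (c i) t (b i))))

    y z z′ : Point R d
    y = comb b x
    z = comb c x
    z′ = comb c′ x

    yz≡yy : inner y z ≡ norm² y
    yz≡yy = average c x Σc≡1 b-affine

    z′z′ : norm² z′ ≡ s * (s * norm² z + t * norm² y) + t * norm² y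
    z′z′ = trans (inner-lin s t c b x z′) (cong₂ (λ A B → s * A + t * B)
      (trans (inner-comm z′ z) (trans (inner-lin s t c b x z)
        (cong (λ e → s * norm² z + t * e) (trans (inner-comm z y) yz≡yy))))
      (trans (inner-comm z′ y) (average c′ x Σc′≡1 b-affine)))

    -- y is orthogonal to z - y, so ‖z′‖² = ‖y‖² + s² (‖z‖² - ‖y‖²); the drop is (1 - s²) (‖z‖² -
    -- ‖y‖²), with 1 - s² = t (1 + s).
    closer : norm² z′ ≤ norm² z
    closer = x+e≡y⇒x≤y
      (*-nonneg (*-nonneg 0≤t (+-nonneg (inj₁ 0<1) 0≤s))
        (x≤y⇒0≤y-x (norm²≤inner⇒norm²-≤ y z (inj₂ (sym yz≡yy)))))
      (trans (cong (_+ t * (1# + s) * (norm² z + - norm² y)) z′z′)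
        (solve 3 (λ t Z Y → let s = one :+ :- t in
             s :* (s :* Z :+ t :* Y) :+ t :* Y :+ t :* (one :+ s) :* (Z :+ :- Y) := Z) refl t (norm² z) (norm² y)))

  extend-nearest : ∀ {d q} (x : Fin (suc q) → Point R d) k {c} → IsNearest (x ∘ punchIn k) c →
                   norm² (comb c (x ∘ punchIn k)) ≤ inner (comb c (x ∘ punchIn k)) (x k) →
                   IsNearest x (insertAt c k 0#)
  extend-nearest {d} x k {c} ((0≤c , Σc≡1) , pp≤px) pp≤pxk =
    (insertAt-nonneg k ≤-refl 0≤c , trans (sum-insertAt c k 0#) (trans (+-identityˡ _) Σc≡1)) ,
    λ i → subst₂ _≤_ (sym (inner-cong p′≗p p′≗p)) (sym (inner-cong p′≗p λ _ → refl))
            (punchIn-elim {P = λ i → norm² p ≤ inner p (x i)} k pp≤pxk pp≤px i)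
    where
    p : Point R d
    p = comb c (x ∘ punchIn k)
    p′≗p : comb (insertAt c k 0#) x ≗ p
    p′≗p t = trans (comb-insertAt c k 0# x t) (trans (cong (_+ p t) (zeroˡ _)) (+-identityˡ _))

  mix-insertAt : ∀ {d q} (x : Fin (suc q) → Point R d) k {c s t} → Weights c → 0# ≤ s → 0# ≤ t → t + s ≡ 1# →
                 Weights (insertAt (λ j → s * c j) k t) ×
                 comb (insertAt (λ j → s * c j) k t) x ≗ λ i → s * comb c (x ∘ punchIn k) i + t * x k i
  mix-insertAt x k {c} {s} {t} (0≤c , Σc≡1) 0≤s 0≤t t+s≡1 =
    ( insertAt-nonneg k 0≤t (λ j → *-nonneg 0≤s (0≤c j))
    , trans (sum-insertAt _ k t)
        (trans (cong (t +_) (trans (sum-*ˡ s c) (trans (cong (s *_) Σc≡1) (*-identityʳ s)))) t+s≡1)) ,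
    λ i → begin
      comb (insertAt (λ j → s * c j) k t) x i
        ≡⟨ comb-insertAt _ k t x i ⟩
      t * x k i + sum (λ j → s * c j * x (punchIn k j) i)
        ≡⟨ cong (t * x k i +_) (trans (sum-cong λ j → *-assoc s (c j) _) (sum-*ˡ s _)) ⟩
      t * x k i + s * comb c (x ∘ punchIn k) i
        ≡⟨ +-comm _ _ ⟩
      s * comb c (x ∘ punchIn k) i + t * x k i ∎

  -- If an added point lies strictly on the near side of the nearest point p, the affine minimiser is
  -- nearest for the extended family, or else a retraction towards it reaches a subfamily closer than p.
  improve : ∀ {d q} (x : Fin (suc q) → Point R d) k {c} → Weights c →
            inner (comb c (x ∘ punchIn k)) (x k) < norm² (comb c (x ∘ punchIn k)) →
            ∃ (IsNearest x) ⊎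
            ∃ λ j → ∃ λ c′ → Weights c′ × norm² (comb c′ (x ∘ punchIn j)) < norm² (comb c (x ∘ punchIn k))
  improve x k {c} wc pxk<pp =
    let b , Σb≡1 , b-affine = affine-nearest x
        s , t , 0≤s , 0≤t , t+s≡1 , zz<pp = move-closer (comb c (x ∘ punchIn k)) (x k) pxk<pp
        wz , z≗ = mix-insertAt x k wc 0≤s 0≤t t+s≡1
    in case any? (λ i → b i <ᶠ? 0#) of λ where
      (no ¬neg) → inj₁ (b ,
        ((λ i → nonneg-by (≤-or-> 0# (b i)) λ bi<0 → ¬neg (i , bi<0)) , Σb≡1) , λ i → inj₂ (sym (b-affine i)))
      (yes neg) →
        let c′ , wc′ , (j , c′j≡0) , z′z′≤zz = retract x b _ Σb≡1 b-affine wz neg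
            drop = comb-punchIn j c′j≡0 x
        in inj₂ (j , c′ ∘ punchIn j , punchIn-Weights j c′j≡0 wc′ ,
             ≤-<-trans (≤-trans (inj₂ (sym (inner-cong drop drop))) z′z′≤zz)
               (subst (_< norm² (comb c (x ∘ punchIn k))) (sym (inner-cong z≗ z≗)) zz<pp))
    where
    nonneg-by : ∀ {a} → 0# ≤ a ⊎ a < 0# → ¬ a < 0# → 0# ≤ a
    nonneg-by (inj₁ 0≤a) _ = 0≤a
    nonneg-by (inj₂ a<0) a≮0 = contradiction a<0 a≮0

  -- The closest among the nearest points of the subfamilies omitting one member cannot be improved.
  nearest-step : ∀ {d q} (x : Fin (suc q) → Point R d) (c : Fin (suc q) → Fin q → Carrier) →
                 (∀ k → IsNearest (x ∘ punchIn k) (c k)) → ∃ (IsNearest x)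
  nearest-step x c near with argmin (λ k → norm² (comb (c k) (x ∘ punchIn k))) (λ _ → yes tt) (zero , tt)
  ... | k , _ , min with ≤-or-> (norm² (comb (c k) (x ∘ punchIn k))) (inner (comb (c k) (x ∘ punchIn k)) (x k))
  ...   | inj₁ pp≤pxk = insertAt (c k) k 0# , extend-nearest x k (near k) pp≤pxk
  ...   | inj₂ pxk<pp with improve x k (proj₁ (near k)) pxk<pp
  ...     | inj₁ found = found
  ...     | inj₂ (j , c′ , wc′ , closer) =
    contradiction (≤-trans (min j tt) (nearest-minimal (near j) wc′)) (<⇒≱ closer)

  -- Induction over the subfamilies with one member left out takes the place of a compactness
  -- argument.
  nearest : ∀ {d} q (x : Fin (suc q) → Point R d) → ∃ (IsNearest x)
  nearest zero x = (λ _ → 1#) , ((λ _ → inj₁ 0<1) , Σ≡1) , λ where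
      zero → inj₂ (average (λ _ → 1#) x Σ≡1 λ { zero → refl })
    where
    Σ≡1 : sum {1} (λ _ → 1#) ≡ 1#
    Σ≡1 = trans (sum-suc _) (trans (cong (1# +_) (sum-zero λ ())) (+-identityʳ 1#))
  nearest (suc q) x = nearest-step x (λ k → proj₁ (nearest q (x ∘ punchIn k))) (λ k → proj₂ (nearest q (x ∘ punchIn k)))

  -- Complementary slackness: the excesses ⟨q, x_i⟩ - ‖q‖² are nonnegative and have weighted sum 0,
  -- so they vanish where the weight does not. Pairing the dependence with q then gives ‖q‖² `sum a`
  -- = 0.
  nearest-affine : ∀ {d q} (x : Fin q → Point R d) c → IsNearest x c → norm² (comb c x) ≢ 0# → (∀ i → c i ≢ 0#) →
                   ∀ a → (∀ t → comb a x t ≡ 0#) → sum a ≡ 0#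
  nearest-affine {d} x c ((0≤c , Σc≡1) , qq≤qx) qq≢0 c≢0 a rel = Σa≡0
    where
    q : Point R d
    q = comb c x
    on-plane : ∀ i → inner q (x i) ≡ norm² q
    on-plane i = begin
      inner q (x i)
        ≡⟨ solve 2 (λ a b → a := a :+ :- b :+ b) refl _ (norm² q) ⟩
      inner q (x i) + - norm² q + norm² q
        ≡⟨ cong (_+ norm² q) (*-cancel-0 (c≢0 i)
             (sum-nonneg≡0 (λ i → *-nonneg (0≤c i) (x≤y⇒0≤y-x (qq≤qx i)))
               (trans (excess q (norm² q) c x Σc≡1) (-‿inverseʳ _)) i)) ⟩
      0# + norm² q
        ≡⟨ +-identityˡ _ ⟩
      norm² q ∎
    Σa≡0 : sum a ≡ 0#
    Σa≡0 = *-cancel-0 qq≢0 (begin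
      norm² q * sum a                 ≡⟨ *-comm _ _ ⟩
      sum a * norm² q                 ≡⟨ sym (sum-*ʳ (norm² q) a) ⟩
      sum (λ i → a i * norm² q)       ≡⟨ sum-cong (λ i → cong (a i *_) (sym (on-plane i))) ⟩
      sum (λ i → a i * inner q (x i)) ≡⟨ sym (inner-combʳ q a x) ⟩
      inner q (comb a x)              ≡⟨ inner-comm q _ ⟩
      inner (comb a x) q              ≡⟨ inner-zeroˡ q rel ⟩
      0#                              ∎)

  -- If all weights of a nearest point q ≠ 0 are positive, the points lie on {⟨q, ·⟩ = ‖q‖²}, so every linear
  -- dependence among them is affine and can be subtracted until a weight vanishes.
  caratheodory : ∀ {d} (x : Fin (suc d) → Point R d) c → IsNearest x c → norm² (comb c x) ≢ 0# →
                 ∃ λ j → ∃ λ c′ → Weights c′ × norm² (comb c′ (x ∘ punchIn j)) ≡ norm² (comb c x)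
  caratheodory {d} x c near@(wc@(0≤c , Σc≡1) , _) qq≢0 with any? (λ i → c i ≟ᶠ 0#)
  ... | yes (j , cj≡0) = j , c ∘ punchIn j , punchIn-Weights j cj≡0 wc ,
    sym (inner-cong (comb-punchIn j cj≡0 x) (comb-punchIn j cj≡0 x))
  ... | no ¬c≡0 with dependent d x
  ...   | a , (i , ai≢0) , rel with nearest-affine x c near qq≢0 (λ i ci≡0 → ¬c≡0 (i , ci≡0)) a rel
  ...     | Σa≡0 with any? (λ i → a i <ᶠ? 0#)
  -- A nonzero a with sum 0 has a negative entry.
  ...       | no ¬neg = contradiction (sum-nonneg≡0 0≤a Σa≡0 i) ai≢0
    where
    0≤a : ∀ i → 0# ≤ a i
    0≤a i with ≤-or-> 0# (a i)
    ... | inj₁ 0≤ai = 0≤ai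
    ... | inj₂ ai<0 = contradiction (i , ai<0) ¬neg
  ...       | yes neg with ratio-test c a 0≤c neg
  ...         | t , 0≤t , nonneg , j , exact =
    j , c′ ∘ punchIn j , punchIn-Weights j c′j≡0 ((λ i → subst (0# ≤_) (same i) (nonneg i)) , Σc′≡1) ,
    trans (sym (inner-cong (comb-punchIn j c′j≡0 x) (comb-punchIn j c′j≡0 x))) (inner-cong unmoved unmoved)
    where
    c′ : Fin (suc d) → Carrier
    c′ i = 1# * c i + t * a i
    same : ∀ i → c i + t * a i ≡ c′ i
    same i = cong (_+ t * a i) (sym (*-identityˡ (c i)))
    c′j≡0 : c′ j ≡ 0#
    c′j≡0 = trans (sym (same j)) exact
    Σc′≡1 : sum c′ ≡ 1#
    Σc′≡1 = trans (sum-mix 1# t c a) (trans (cong₂ (λ A B → 1# * A + t * B) Σc≡1 Σa≡0)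
      (solve 1 (λ t → one :* one :+ t :* nil := one) refl t))
    unmoved : comb c′ x ≗ comb c x
    unmoved i = trans (sum-lin 1# t c a (λ j → x j i)) (trans (cong (λ e → 1# * comb c x i + t * e) (rel i))
      (solve 2 (λ c t → one :* c :+ t :* nil := c) refl (comb c x i) t))

-- Counting colours and greedy selection.

module Counting where
  open import Data.Nat using (_+_; _∸_; _≤_; _<_)

  ∣p∪q∣≤∣p∣+∣q∣ : ∀ {r} (p q : Subset r) → ∣ p ∪ q ∣ ≤ ∣ p ∣ + ∣ q ∣
  ∣p∪q∣≤∣p∣+∣q∣ [] [] = z≤n
  ∣p∪q∣≤∣p∣+∣q∣ (inside ∷ p) (inside ∷ q) =
    s≤s (ℕₚ.≤-trans (∣p∪q∣≤∣p∣+∣q∣ p q) (ℕₚ.+-monoʳ-≤ ∣ p ∣ (ℕₚ.n≤1+n ∣ q ∣)))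
  ∣p∪q∣≤∣p∣+∣q∣ (inside ∷ p) (outside ∷ q) = s≤s (∣p∪q∣≤∣p∣+∣q∣ p q)
  ∣p∪q∣≤∣p∣+∣q∣ (outside ∷ p) (inside ∷ q) =
    ℕₚ.≤-trans (s≤s (∣p∪q∣≤∣p∣+∣q∣ p q)) (ℕₚ.≤-reflexive (sym (ℕₚ.+-suc ∣ p ∣ ∣ q ∣)))
  ∣p∪q∣≤∣p∣+∣q∣ (outside ∷ p) (outside ∷ q) = ∣p∪q∣≤∣p∣+∣q∣ p q

  ∣p∪⁅x⁆∣≤1+∣p∣ : ∀ {r} (p : Subset r) x → ∣ p ∪ ⁅ x ⁆ ∣ ≤ suc ∣ p ∣
  ∣p∪⁅x⁆∣≤1+∣p∣ p x = ℕₚ.≤-trans (∣p∪q∣≤∣p∣+∣q∣ p ⁅ x ⁆)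
    (ℕₚ.≤-reflexive (trans (cong (∣ p ∣ +_) (∣⁅x⁆∣≡1 x)) (ℕₚ.+-comm ∣ p ∣ 1)))

  x∉p⇒∣p∣<∣p∪⁅x⁆∣ : ∀ {r} {p : Subset r} {x} → x ∉ p → ∣ p ∣ < ∣ p ∪ ⁅ x ⁆ ∣
  x∉p⇒∣p∣<∣p∪⁅x⁆∣ {p = p} {x} x∉p = p⊂q⇒∣p∣<∣q∣ (p⊆p∪q ⁅ x ⁆ , x , q⊆p∪q p ⁅ x ⁆ (x∈⁅x⁆ x) , x∉p)

  subset-of-size : ∀ {r} (p : Subset r) s → s ≤ ∣ p ∣ → ∃ λ C → C ⊆ p × ∣ C ∣ ≡ s
  subset-of-size {r} p zero _ = Sub.⊥ , (λ x∈⊥ → contradiction x∈⊥ ∉⊥) , ∣⊥∣≡0 r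
  subset-of-size (inside ∷ p) (suc s) (s≤s s≤p) with subset-of-size p s s≤p
  ... | C , C⊆p , ∣C∣≡s = inside ∷ C , s⊆s C⊆p , cong suc ∣C∣≡s
  subset-of-size (outside ∷ p) (suc s) s≤p with subset-of-size p (suc s) s≤p
  ... | C , C⊆p , ∣C∣≡s = outside ∷ C , s⊆s C⊆p , ∣C∣≡s

  ∈-colorsUsed : ∀ {q r} (f : Fin q → Fin r) j → f j ∈ colorsUsed f
  ∈-colorsUsed f j = lookup⇒[]= (f j) (colorsUsed f)
    (trans (lookup∘tabulate _ (f j)) (dec-true (any? λ i → f i Fin.≟ f j) (j , refl)))

  colorsUsed-⊆ : ∀ {q r} (f : Fin q → Fin r) {D} → (∀ j → f j ∈ D) → colorsUsed f ⊆ D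
  colorsUsed-⊆ f {D} f∈D {x} x∈ with any? (λ i → f i Fin.≟ x) in eq
  ... | yes (j , refl) = f∈D j
  ... | no _ with () ← trans (sym (trans (lookup∘tabulate _ x) (cong does eq))) ([]=⇒lookup x∈)

  -- Bounds from below the number of indices that w misses: if D contains all of them, E is
  -- everything.
  enlarge : ∀ {d n} (w : Fin d → Fin n) (D : Subset n) → ∃ λ E → ∣ E ∣ ≤ d + ∣ D ∣ × D ⊆ E × (∀ j → w j ∈ E)
  enlarge {zero} w D = D , ℕₚ.≤-refl , id , λ ()
  enlarge {suc d} w D with enlarge (w ∘ suc) D
  ... | E , E≤ , D⊆E , w∈E = E ∪ ⁅ w zero ⁆ , ℕₚ.≤-trans (∣p∪⁅x⁆∣≤1+∣p∣ E (w zero)) (s≤s E≤) , p⊆p∪q _ ∘ D⊆E , λ where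
    zero → q⊆p∪q E _ (x∈⁅x⁆ (w zero))
    (suc j) → p⊆p∪q _ (w∈E j)

  cons-injective : ∀ {A : Set} {q} {v : A} {w : Fin q → A} → Injective _≡_ _≡_ w → (∀ j → w j ≢ v) →
                   Injective _≡_ _≡_ (cons v w)
  cons-injective w-inj w≢v {zero} {zero} _ = refl
  cons-injective w-inj w≢v {zero} {suc j} v≡wj = contradiction (sym v≡wj) (w≢v j)
  cons-injective w-inj w≢v {suc i} {zero} wi≡v = contradiction wi≡v (w≢v i)
  cons-injective w-inj w≢v {suc i} {suc j} wi≡wj = cong suc (w-inj wi≡wj)

  ++-injective : ∀ {A : Set} {d m} {w : Fin d → A} {v : Fin m → A} → Injective _≡_ _≡_ w → Injective _≡_ _≡_ v →
                 (∀ i j → w i ≢ v j) → Injective _≡_ _≡_ (w ++ v)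
  ++-injective {d = d} w-inj v-inj w≢v {i} {j} eq with splitAt d i in i≡ | splitAt d j in j≡
  ... | inj₁ i′ | inj₁ j′ = trans (sym (splitAt⁻¹-↑ˡ i≡)) (trans (cong (_↑ˡ _) (w-inj eq)) (splitAt⁻¹-↑ˡ j≡))
  ... | inj₁ i′ | inj₂ j′ = contradiction eq (w≢v i′ j′)
  ... | inj₂ i′ | inj₁ j′ = contradiction (sym eq) (w≢v j′ i′)
  ... | inj₂ i′ | inj₂ j′ = trans (sym (splitAt⁻¹-↑ʳ i≡)) (trans (cong (d ↑ʳ_) (v-inj eq)) (splitAt⁻¹-↑ʳ j≡))

  all-or : ∀ {n} {A : Fin n → Set} {B : Set} → (∀ i → A i ⊎ B) → (∀ i → A i) ⊎ B
  all-or {zero} _ = inj₁ λ ()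
  all-or {suc n} h with h zero | all-or (h ∘ suc)
  ... | inj₂ b | _ = inj₂ b
  ... | inj₁ _ | inj₂ b = inj₂ b
  ... | inj₁ a | inj₁ as = inj₁ λ where
    zero → a
    (suc i) → as i

  -- B holds the colours already present. The joint number of colours is bounded through every D
  -- containing them and the new ones, so that `conclude` can insert the palette of the concatenated
  -- family for D.
  Selection : ∀ {n r} (m k : ℕ) (col : Fin n → Fin r) (G : Fin n → Set) (B : Subset r) → Set
  Selection {n} m k col G B = ∃ λ (v : Fin m → Fin n) → Injective _≡_ _≡_ v × (∀ i → G (v i)) ×
    (∀ D → B ⊆ D → (∀ i → col (v i) ∈ D) → k ≤ ∣ D ∣)

  -- Greedy choice: take a new colour while there is one. That the image of G under κ has at least m elements
  -- is expressed by quantifying over the supersets D of the image.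
  select : ∀ {n r s} m k (col : Fin n → Fin r) (κ : Fin n → Fin s) {G : Fin n → Set} → (∀ v → Dec (G v)) →
           (B : Subset r) →
           (∀ D → (∀ v → G v → κ v ∈ D) → m ≤ ∣ D ∣) →
           k ≤ ∣ B ∣ + m →
           (∀ D → B ⊆ D → (∀ v → G v → col v ∈ D) → k ≤ ∣ D ∣) →
           Selection m k col G B
  select zero k col κ G? B _ k≤B+0 _ = (λ ()) , (λ {i} → contradiction i λ ()) , (λ ()) ,
    λ D B⊆D _ → ℕₚ.≤-trans k≤B+0 (ℕₚ.≤-trans (ℕₚ.≤-reflexive (ℕₚ.+-identityʳ _)) (p⊆q⇒∣p∣≤∣q∣ B⊆D))
  select {n} {r} {s} (suc m) k col κ {G} G? B many k≤B+m covers = case any? (λ g → G? g ×-dec ¬? (col g ∈? B)) of λ where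
      (yes (g , Gg , new)) → take g Gg (ℕₚ.≤-trans k≤B+m
        (ℕₚ.≤-trans (ℕₚ.≤-reflexive (ℕₚ.+-suc ∣ B ∣ m)) (ℕₚ.+-monoˡ-≤ m (x∉p⇒∣p∣<∣p∪⁅x⁆∣ new))))
      (no ¬new) → case any? G? of λ where
        (yes (g , Gg)) → take g Gg (ℕₚ.≤-trans
          -- When G offers no new colour, B contains all its colours, so B alone has at least k
          -- elements and any g may be taken.
          (covers B id λ v Gv → decidable-stable (col v ∈? B) λ new → ¬new (v , Gv , new))
          (ℕₚ.≤-trans (∣p∣≤∣p∪q∣ B ⁅ col g ⁆) (ℕₚ.m≤m+n _ m)))
        (no ¬G) → contradiction (ℕₚ.≤-trans (many Sub.⊥ λ v Gv → contradiction (v , Gv) ¬G) (ℕₚ.≤-reflexive (∣⊥∣≡0 s)))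
          λ ()
    where
    take : ∀ g → G g → k ≤ ∣ B ∪ ⁅ col g ⁆ ∣ + m → Selection (suc m) k col G B
    take g Gg k≤ =
      let B′ = B ∪ ⁅ col g ⁆
          v , v-inj , Gv , colours = select m k col κ (λ v → G? v ×-dec ¬? (v Fin.≟ g)) B′
            -- Removing g from G costs the image at most the single value `κ g`.
            (λ D h → ℕₚ.≤-pred (ℕₚ.≤-trans
              (many (D ∪ ⁅ κ g ⁆) λ v Gv → case v Fin.≟ g of λ where
                (yes refl) → q⊆p∪q D _ (x∈⁅x⁆ (κ g))
                (no v≢g) → p⊆p∪q _ (h v (Gv , v≢g)))
              (∣p∪⁅x⁆∣≤1+∣p∣ D (κ g))))
            k≤
            (λ D B′⊆D h → covers D (B′⊆D ∘ p⊆p∪q _) λ v Gv → case v Fin.≟ g of λ where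
                (yes refl) → B′⊆D (q⊆p∪q B _ (x∈⁅x⁆ (col g)))
                (no v≢g) → h v (Gv , v≢g))
      in cons g v , cons-injective v-inj (λ i → proj₂ (Gv i)) ,
         (λ where
            zero → Gg
            (suc i) → proj₁ (Gv i)) ,
         λ D B⊆D h → colours D
           (λ x∈B′ → case x∈p∪q⁻ B _ x∈B′ of λ where
              (inj₁ x∈B) → B⊆D x∈B
              (inj₂ x∈g) → subst (_∈ D) (sym (x∈⁅y⁆⇒x≡y (col g) x∈g)) (h zero))
           (h ∘ suc)

-- The exchange argument and the descent over tuples.

module Minimisation (R : RealField) {d r m k n : ℕ}
  (m≤k : m ℕ.≤ k) (k≤m+d : k ℕ.≤ m ℕ.+ suc d) (k≤r : k ℕ.≤ r) (m+d≤n : m ℕ.+ suc d ℕ.≤ n)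
  (P : Fin n → Point R (suc d)) (col : Fin n → Fin r)
  (classes : (C : Subset r) → ∣ C ∣ ≡ r ℕ.∸ k ℕ.+ 1 → 0∈conv R P (λ i → col i ∈ C))
  where
  open OrderedField R
  open EuclideanSpace R
  open ConvexHull R
  open Counting

  -- Otherwise some r − k + 1 classes would lie strictly on one side of a hyperplane through the origin.
  halfspace-colours : ∀ (y : Point R (suc d)) (D : Subset r) →
                      (∀ v → inner y (P v) ≤ 0# → col v ∈ D) → k ℕ.≤ ∣ D ∣
  halfspace-colours y D h with k ℕ.≤? ∣ D ∣
  ... | yes k≤D = k≤D
  ... | no k≰D with subset-of-size (∁ D) (r ℕ.∸ k ℕ.+ 1) small
    where
    small : r ℕ.∸ k ℕ.+ 1 ℕ.≤ ∣ ∁ D ∣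
    small = subst₂ ℕ._≤_ (ℕₚ.+-comm 1 (r ℕ.∸ k)) (sym (∣∁p∣≡n∸∣p∣ D)) (ℕₚ.∸-monoʳ-< (ℕₚ.≰⇒> k≰D) k≤r)
  ... | C , C⊆∁D , ∣C∣≡ with classes C ∣C∣≡
  ...   | c , 0≤c , supported , Σc≡1 , Σcp≡0 =
    contradiction (trans (sym (sum-zero c≡0)) (trans (sum≡∑ c) Σc≡1)) 0≢1
    where
    in-front : ∀ i → col i ∈ C → 0# < inner y (P i)
    in-front i i∈C with ≤-or-> (inner y (P i)) 0#
    ... | inj₁ yp≤0 = contradiction (h i yp≤0) (x∈∁p⇒x∉p (C⊆∁D i∈C))
    ... | inj₂ 0<yp = 0<yp

    term-nonneg : ∀ i → 0# ≤ c i * inner y (P i)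
    term-nonneg i with col i ∈? C
    ... | yes i∈C = *-nonneg (0≤c i) (inj₁ (in-front i i∈C))
    ... | no i∉C = inj₂ (sym (trans (cong (_* inner y (P i)) (supported i i∉C)) (zeroˡ _)))

    terms≡0 : ∀ i → c i * inner y (P i) ≡ 0#
    terms≡0 = sum-nonneg≡0 term-nonneg (trans (sym (inner-combʳ y c P))
      (trans (inner-comm y (comb c P)) (inner-zeroˡ y λ t → trans (sum≡∑ _) (Σcp≡0 t))))

    c≡0 : ∀ i → c i ≡ 0#
    c≡0 i with col i ∈? C
    ... | yes i∈C = *-cancel-0 (pos⇒≢0 (in-front i i∈C)) (trans (*-comm _ _) (terms≡0 i))
    ... | no i∉C = supported i i∉C

  points : (Fin (suc d) → Fin n) → Fin n → Fin (suc (suc d)) → Point R (suc d)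
  points w v = cons (P v) (λ j → P (w j))

  HitBy : (Fin (suc d) → Fin n) → Fin n → Set
  HitBy w v = 0∈conv R (points w v) (λ _ → ⊤)

  Weights⇒HitBy : ∀ w v {c} → Weights c → (∀ t → comb c (points w v) t ≡ 0#) → HitBy w v
  Weights⇒HitBy w v {c} (0≤c , Σc≡1) vanish =
    c , 0≤c , (λ _ ¬⊤ → contradiction tt ¬⊤) , trans (sym (sum≡∑ c)) Σc≡1 ,
    λ t → trans (sym (sum≡∑ λ i → c i * points w v i t)) (vanish t)

  HitBy-cong : ∀ {w w′ v v′} → w ≗ w′ → v ≡ v′ → HitBy w v → HitBy w′ v′
  HitBy-cong {w} {w′} {v} w≗w′ refl (c , 0≤c , _ , Σc≡1 , Σcp≡0) =
    Weights⇒HitBy w′ v (0≤c , trans (sum≡∑ c) Σc≡1) λ t →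
      trans (sum-cong λ i → cong (c i *_) (same i t)) (trans (sum≡∑ λ i → c i * points w v i t) (Σcp≡0 t))
    where
    same : ∀ i t → points w′ v i t ≡ points w v i t
    same zero t = refl
    same (suc j) t = cong (λ i → P i t) (sym (w≗w′ j))

  -- Exchanges act on index tuples and produce `P ∘ cons v w`, whereas the theorem speaks of
  -- `points w v`; the two families agree only pointwise.
  comb-points : ∀ w v c → comb c (P ∘ cons v w) ≗ comb c (points w v)
  comb-points w v c t = sum-cong λ i → cong (c i *_) (same i)
    where
    same : ∀ i → P (cons v w i) t ≡ points w v i t
    same zero = refl
    same (suc j) = refl

  Conclusion : Set
  Conclusion = Σ (Fin (suc d ℕ.+ m) → Fin n) λ w →
    Injective _≡_ _≡_ w ×
    k ℕ.≤ ∣ colorsUsed (λ j → col (w j)) ∣ ×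
    ((i : Fin m) → HitBy (λ j → w (j ↑ˡ m)) (w (suc d ↑ʳ i)))

  palette : (Fin (suc d) → Fin n) → Subset r
  palette w = colorsUsed (col ∘ w)

  -- The colour bound k - m without truncated subtraction: the m points still to be chosen can
  -- supply the missing colours.
  Admissible : (Fin (suc d) → Fin n) → Set
  Admissible w = Injective _≡_ _≡_ w × k ℕ.≤ ∣ palette w ∣ ℕ.+ m

  conclude : ∀ {G w} → Admissible w → (∀ v → G v → (∀ j → w j ≢ v) × HitBy w v) →
             Selection m k col G (palette w) → Conclusion
  conclude {G} {w} (w-inj , _) good (v , v-inj , Gv , colours) =
    w ++ v , ++-injective w-inj v-inj (λ j i → proj₁ (good (v i) (Gv i)) j) ,
    colours (colorsUsed (λ j → col ((w ++ v) j)))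
      (colorsUsed-⊆ (col ∘ w) λ j → subst (_∈ colorsUsed (λ j → col ((w ++ v) j)))
        (cong col (lookup-++ˡ w v j)) (∈-colorsUsed (λ j → col ((w ++ v) j)) (j ↑ˡ m)))
      (λ i → subst (_∈ colorsUsed (λ j → col ((w ++ v) j)))
        (cong col (lookup-++ʳ w v i)) (∈-colorsUsed (λ j → col ((w ++ v) j)) (suc d ↑ʳ i))) ,
    λ i → HitBy-cong (λ j → sym (lookup-++ˡ w v j)) (sym (lookup-++ʳ w v i)) (proj₂ (good (v i) (Gv i)))

  initial : ∃ Admissible
  initial with select (suc d) (k ℕ.∸ m) col id {G = λ _ → ⊤} (λ _ → yes tt) Sub.⊥
      (λ D all → ℕₚ.≤-trans (ℕₚ.≤-trans (ℕₚ.m≤n+m (suc d) m) m+d≤n)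
        (ℕₚ.≤-trans (ℕₚ.≤-reflexive (sym (∣⊤∣≡n n))) (p⊆q⇒∣p∣≤∣q∣ {p = Sub.⊤} λ {v} _ → all v tt)))
      (ℕₚ.≤-trans (ℕₚ.m≤n+o⇒m∸n≤o k m k≤m+d) (ℕₚ.m≤n+m (suc d) ∣ Sub.⊥ {r} ∣))
      -- With normal 0 the half-space is the whole space, so all of P together has at least k
      -- colours.
      (λ D _ all → ℕₚ.≤-trans (ℕₚ.m∸n≤m k m) (halfspace-colours (λ _ → 0#) D λ v _ → all v tt))
  ... | w , w-inj , _ , colours = w , w-inj ,
    ℕₚ.≤-trans (ℕₚ.m≤n+m∸n k m) (ℕₚ.≤-trans
      (ℕₚ.+-monoʳ-≤ m (colours (palette w) (λ x∈⊥ → contradiction x∈⊥ ∉⊥) (∈-colorsUsed (col ∘ w))))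
      (ℕₚ.≤-reflexive (ℕₚ.+-comm m ∣ palette w ∣)))

  -- A nearest point requires a nonempty tuple; this is why the dimension has the form `suc d`.
  optimum : (w : Fin (suc d) → Fin n) → ∃ (IsNearest (P ∘ w))
  optimum w = nearest d (P ∘ w)

  point : (Fin (suc d) → Fin n) → Point R (suc d)
  point w = comb (proj₁ (optimum w)) (P ∘ w)

  distance² : (Fin (suc d) → Fin n) → Carrier
  distance² w = norm² (point w)

  -- `optimum` may choose different weights for pointwise equal tuples, but minimality compares the
  -- distances. Needed because decoding an encoded tuple returns it only pointwise.
  distance²-≤ : ∀ {w w′} → w ≗ w′ → distance² w ≤ distance² w′
  distance²-≤ {w} {w′} w≗w′ = ≤-trans
    (nearest-minimal (proj₂ (optimum w)) (proj₁ (proj₂ (optimum w′))))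
    (inj₂ (inner-cong same same))
    where
    same : comb (proj₁ (optimum w′)) (P ∘ w) ≗ point w′
    same t = sum-cong λ i → cong (λ j → proj₁ (optimum w′) i * P j t) (w≗w′ i)

  -- Otherwise ‖p − q‖² ≤ ‖p‖² − ‖q‖² ≤ 0, so p = q, although ⟨p, x₀⟩ ≤ 0 < ‖q‖² ≤ ⟨q, x₀⟩.
  strictly-closer : ∀ {q} (x : Fin (suc q) → Point R (suc d)) {c c′} → IsNearest (x ∘ suc) c → IsNearest x c′ →
                    inner (comb c (x ∘ suc)) (x zero) ≤ 0# → norm² (comb c′ x) ≢ 0# →
                    norm² (comb c′ x) < norm² (comb c (x ∘ suc))
  strictly-closer x {c} {c′} (wc , _) (wc′ , qq≤qx) px₀≤0 qq≢0 with ≤-or-> (norm² (comb c (x ∘ suc))) (norm² (comb c′ x))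
  ... | inj₂ qq<pp = qq<pp
  ... | inj₁ pp≤qq = contradiction
    (subst (_≤ 0#) px₀≡qx₀ px₀≤0)
    (<⇒≱ (<-≤-trans (nonneg∧≢0⇒pos (norm²-nonneg q) qq≢0) (qq≤qx zero)))
    where
    p q : Point R (suc d)
    p = comb c (x ∘ suc)
    q = comb c′ x

    qq≤pq : norm² q ≤ inner p q
    qq≤pq = subst (norm² q ≤_) (inner-comm q p) (average-≥ (x ∘ suc) wc (qq≤qx ∘ suc))

    p≡q : norm² (p ⊖ q) ≡ 0#
    p≡q = ≤-antisym
      (x+e≡y⇒x≤y
        (+-nonneg (x≤y⇒0≤y-x (≤-trans pp≤qq qq≤pq)) (x≤y⇒0≤y-x qq≤pq))
        (trans (cong (_+ (inner p q + - norm² p + (inner p q + - norm² q))) (norm²-⊖ p q))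
          (solve 3 (λ A B C → A :+ :- B :+ (:- B :+ C) :+ (B :+ :- A :+ (B :+ :- C)) := nil)
            refl (norm² p) (inner p q) (norm² q))))
      (norm²-nonneg (p ⊖ q))

    px₀≡qx₀ : inner p (x zero) ≡ inner q (x zero)
    px₀≡qx₀ = inner-cong {x = p} {q} (λ t → trans
      (solve 2 (λ a b → a := a :+ :- b :+ b) refl (p t) (q t))
      (trans (cong (_+ q t) (norm²≡0⇒≡0 (p ⊖ q) p≡q t)) (+-identityˡ (q t)))) (λ _ → refl)

  Improvement : (Fin (suc d) → Fin n) → Set
  Improvement w = ∃ λ w′ → Admissible w′ × distance² w′ < distance² w

  -- The second component pays for the colour that may be lost when a point is dropped after adding
  -- v.
  Candidate : (Fin (suc d) → Fin n) → Fin n → Set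
  Candidate w v = inner (point w) (P v) ≤ 0# × (k ℕ.< ∣ palette w ∣ ℕ.+ m ⊎ col v ∉ palette w)

  candidate? : ∀ w v → Dec (Candidate w v)
  candidate? w v = (inner (point w) (P v) ≤ᶠ? 0#) ×-dec
    ((k ℕ.<? ∣ palette w ∣ ℕ.+ m) ⊎-dec ¬? (col v ∈? palette w))

  -- Each member of w has inner product at least ‖p‖² > 0 with p = `point w`.
  opposite⇒∉ : ∀ w v → distance² w ≢ 0# → inner (point w) (P v) ≤ 0# → ∀ j → w j ≢ v
  opposite⇒∉ w v pp≢0 pv≤0 j refl = <⇒≱
    (<-≤-trans (nonneg∧≢0⇒pos (norm²-nonneg (point w)) pp≢0) (proj₂ (proj₂ (optimum w)) j)) pv≤0

  -- Restoring the dropped colour to the new palette B gives a set E of at most |B| + 1 colours that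
  -- contains `palette w` and the colour of v. If that colour is new, E has more colours than w;
  -- otherwise the spare colour absorbs the loss.
  swap-Admissible : ∀ w v → Admissible w → (∀ j → w j ≢ v) → (k ℕ.< ∣ palette w ∣ ℕ.+ m ⊎ col v ∉ palette w) →
                    ∀ j → Admissible (cons v w ∘ punchIn j)
  swap-Admissible w v (w-inj , k≤) w∌v slack j =
    (λ eq → punchIn-injective j _ _ (cons-injective w-inj w∌v eq)) , enough slack
    where
    B E : Subset r
    B = palette (cons v w ∘ punchIn j)
    E = B ∪ ⁅ col (cons v w j) ⁆

    all∈E : ∀ i → col (cons v w i) ∈ E
    all∈E = punchIn-elim {P = λ i → col (cons v w i) ∈ E} j (q⊆p∪q B _ (x∈⁅x⁆ _))
      (λ i → p⊆p∪q _ (∈-colorsUsed (col ∘ cons v w ∘ punchIn j) i))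

    w⊆E : palette w ⊆ E
    w⊆E = colorsUsed-⊆ (col ∘ w) (all∈E ∘ suc)

    enough : k ℕ.< ∣ palette w ∣ ℕ.+ m ⊎ col v ∉ palette w → k ℕ.≤ ∣ B ∣ ℕ.+ m
    enough (inj₁ k<) = ℕₚ.≤-pred (ℕₚ.≤-trans k<
      (ℕₚ.+-monoˡ-≤ m (ℕₚ.≤-trans (p⊆q⇒∣p∣≤∣q∣ w⊆E) (∣p∪⁅x⁆∣≤1+∣p∣ B _))))
    enough (inj₂ new) = ℕₚ.≤-trans k≤ (ℕₚ.+-monoˡ-≤ m (ℕₚ.≤-pred (ℕₚ.≤-trans (x∉p⇒∣p∣<∣p∪⁅x⁆∣ new)
      (ℕₚ.≤-trans (p⊆q⇒∣p∣≤∣q∣ w+v⊆E) (∣p∪⁅x⁆∣≤1+∣p∣ B _)))))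
      where
      w+v⊆E : palette w ∪ ⁅ col v ⁆ ⊆ E
      w+v⊆E x∈ with x∈p∪q⁻ (palette w) _ x∈
      ... | inj₁ x∈w = w⊆E x∈w
      ... | inj₂ x∈v = subst (_∈ E) (sym (x∈⁅y⁆⇒x≡y (col v) x∈v)) (all∈E zero)

  hit-or-improve : ∀ w → Admissible w → distance² w ≢ 0# → ∀ v → Candidate w v → HitBy w v ⊎ Improvement w
  hit-or-improve w adm pp≢0 v (pv≤0 , slack) with nearest (suc d) (P ∘ cons v w)
  ... | c , near with norm² (comb c (P ∘ cons v w)) ≟ᶠ 0#
  ...   | yes qq≡0 = inj₁ (Weights⇒HitBy w v (proj₁ near) λ t →
    trans (sym (comb-points w v c t)) (norm²≡0⇒≡0 (comb c (P ∘ cons v w)) qq≡0 t))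
  ...   | no qq≢0 with caratheodory (P ∘ cons v w) c near qq≢0
  ...     | j , c′ , wc′ , same = inj₂
    ( cons v w ∘ punchIn j
    , swap-Admissible w v adm (opposite⇒∉ w v pp≢0 pv≤0) slack j
    , ≤-<-trans (nearest-minimal (proj₂ (optimum (cons v w ∘ punchIn j))) wc′)
        (subst (_< distance² w) (sym same)
          (strictly-closer (P ∘ cons v w) (proj₂ (optimum w)) near pv≤0 qq≢0)))

  -- Candidates are counted by colour, since distinct colours force distinct points. With a spare
  -- colour, every point of the half-space is a candidate, and its k ≥ m colours suffice.
  select-candidates : ∀ w → Admissible w → Selection m k col (Candidate w) (palette w)
  select-candidates w (_ , k≤) = select m k col col (candidate? w) (palette w) many k≤
    λ D B⊆D h → halfspace-colours (point w) D λ v pv≤0 → case col v ∈? palette w of λ where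
      (yes old) → B⊆D old
      (no new) → h v (pv≤0 , inj₂ new)
    where
    many : ∀ D → (∀ v → Candidate w v → col v ∈ D) → m ℕ.≤ ∣ D ∣
    many D h with k ℕ.<? ∣ palette w ∣ ℕ.+ m
    ... | yes k< = ℕₚ.≤-trans m≤k (halfspace-colours (point w) D λ v pv≤0 → h v (pv≤0 , inj₁ k<))
    -- Now the palette has at most k - m colours, while the palette and D together contain all the
    -- colours of the half-space, at least k in number.
    ... | no k≮ = ℕₚ.+-cancelˡ-≤ ∣ palette w ∣ _ _ (ℕₚ.≤-trans (ℕₚ.≮⇒≥ k≮)
      (ℕₚ.≤-trans (halfspace-colours (point w) (palette w ∪ D) λ v pv≤0 → case col v ∈? palette w of λ where
        (yes old) → p⊆p∪q D old
        (no new) → q⊆p∪q (palette w) D (h v (pv≤0 , inj₂ new)))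
      (∣p∪q∣≤∣p∣+∣q∣ (palette w) D)))

  -- The tuple already has 0 in its hull, so v gets weight 0. Candidates are all points outside w,
  -- and since they may share colours they are counted as points, with κ = `id`.
  conclude-at-origin : ∀ w → Admissible w → distance² w ≡ 0# → Conclusion
  conclude-at-origin w adm@(_ , k≤) pp≡0 = conclude {G = λ v → ¬ ∃ λ j → w j ≡ v} adm
    (λ v v∉w → (λ j wj≡v → v∉w (j , wj≡v)) , hit v)
    (select m k col id (λ v → ¬? (any? λ j → w j Fin.≟ v)) (palette w) many k≤
      λ D B⊆D h → halfspace-colours (point w) D λ v _ → case any? (λ j → w j Fin.≟ v) of λ where
        (yes (j , refl)) → B⊆D (∈-colorsUsed (col ∘ w) j)
        (no v∉w) → h v v∉w)
    where
    hit : ∀ v → HitBy w v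
    hit v = Weights⇒HitBy w v {cons 0# c}
      ( (λ where
          zero → ≤-refl
          (suc j) → 0≤c j)
      , trans (sum-suc _) (trans (+-identityˡ _) Σc≡1))
      λ t → trans (sum-suc _) (trans (cong (_+ point w t) (zeroˡ _))
        (trans (+-identityˡ _) (norm²≡0⇒≡0 (point w) pp≡0 t)))
      where
      c = proj₁ (optimum w)
      0≤c = proj₁ (proj₁ (proj₂ (optimum w)))
      Σc≡1 = proj₂ (proj₁ (proj₂ (optimum w)))

    many : ∀ D → (∀ v → ¬ (∃ λ j → w j ≡ v) → v ∈ D) → m ℕ.≤ ∣ D ∣
    many D h with enlarge w D
    ... | E , E≤ , D⊆E , w∈E = ℕₚ.+-cancelˡ-≤ (suc d) m ∣ D ∣ (ℕₚ.≤-trans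
      (ℕₚ.≤-trans (ℕₚ.≤-reflexive (ℕₚ.+-comm (suc d) m)) m+d≤n)
      (ℕₚ.≤-trans (ℕₚ.≤-trans (ℕₚ.≤-reflexive (sym (∣⊤∣≡n n))) (p⊆q⇒∣p∣≤∣q∣ {p = Sub.⊤} λ {v} _ → all v)) E≤))
      where
      all : ∀ v → v ∈ E
      all v with any? (λ j → w j Fin.≟ v)
      ... | yes (j , refl) = w∈E j
      ... | no v∉w = D⊆E (h v v∉w)

  conclude-or-improve : ∀ w → Admissible w → Conclusion ⊎ Improvement w
  conclude-or-improve w adm with distance² w ≟ᶠ 0#
  ... | yes pp≡0 = inj₁ (conclude-at-origin w adm pp≡0)
  ... | no pp≢0 with all-or (λ v → attempt v (candidate? w v))
    where
    attempt : ∀ v → Dec (Candidate w v) → (Candidate w v → HitBy w v) ⊎ Improvement w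
    attempt v (no ¬cand) = inj₁ λ cand → contradiction cand ¬cand
    attempt v (yes cand) with hit-or-improve w adm pp≢0 v cand
    ... | inj₁ hit = inj₁ λ _ → hit
    ... | inj₂ better = inj₂ better
  ...   | inj₂ better = inj₂ better
  ...   | inj₁ hits = inj₁ (conclude adm
    (λ v cand → opposite⇒∉ w v pp≢0 (proj₁ cand) , hits v cand) (select-candidates w adm))

  -- Tuples are encoded as elements of a finite set, on which every strict partial order is
  -- well-founded; recursion along this order replaces the choice of a minimal tuple.
  _⊏_ : Fin (n ℕ.^ suc d) → Fin (n ℕ.^ suc d) → Set
  i ⊏ j = distance² (finToFun i) < distance² (finToFun j)

  ⊏-wellFounded : WellFounded _⊏_
  ⊏-wellFounded = spo-wellFounded {_≈_ = _≡_} record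
    { isEquivalence = isEquivalence
    ; irrefl = λ where refl → <-irrefl refl
    ; trans = <-trans
    ; <-resp-≈ = (λ where refl i⊏j → i⊏j) , λ where refl i⊏j → i⊏j
    }

  descend : ∀ w → Admissible w → Acc _⊏_ (funToFin w) → Conclusion
  descend w adm (acc smaller) with conclude-or-improve w adm
  ... | inj₁ done = done
  -- Both distances have to be moved to the decoded tuples, which agree with w′ and w only
  -- pointwise.
  ... | inj₂ (w′ , adm′ , closer) = descend w′ adm′ (smaller
    (≤-<-trans (distance²-≤ (finToFun-funToFin w′))
      (<-≤-trans closer (distance²-≤ (λ i → sym (finToFun-funToFin w i))))))

  conclusion : Conclusion
  conclusion = descend (proj₁ initial) (proj₂ initial) (⊏-wellFounded _)

open import Data.Nat using (_+_; _∸_; _≤_)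

theorem6p1 : (R : RealField) → (d r m k n : ℕ) →
  1 ≤ d → d + 1 ≤ r → 1 ≤ m → m ≤ r → m ≤ k → k ≤ m + d → k ≤ r →
  m + d ≤ n → r ≤ n →
  (P : Fin n → Point R d) → (col : Fin n → Fin r) →
  ((C : Subset r) → ∣ C ∣ ≡ r ∸ k + 1 →
     0∈conv R P (λ i → col i ∈ C)) →
  Σ (Fin (d + m) → Fin n) λ w →
    Injective _≡_ _≡_ w ×
    k ≤ ∣ colorsUsed (λ j → col (w j)) ∣ ×
    ((i : Fin m) →
      0∈conv R {d} {suc d}
        (cons (P (w (d ↑ʳ i))) (λ j → P (w (j ↑ˡ m))))
        (λ _ → ⊤))
theorem6p1 R (suc d) r m k n _ _ _ _ m≤k k≤m+d k≤r m+d≤n _ P col classes =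
  Minimisation.conclusion R m≤k k≤m+d k≤r m+d≤n P col classes
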